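{- There exist a finite abelian group $G_1$, a finite index set $\mathcal{W}$, a tuple $(H_w)_{w\in\mathcal{W}}$ of finite abelian groups, and a $(\mathbb{Z}^2\times G_1,(H_w)_{w\in\mathcal{W}})$-property that is both weakly expressible and aperiodic.
   Context: Let $G$ be a finitely generated abelian group and $(H_w)_{w\in\mathcal{W}}$ finite abelian groups indexed by a finite set $\mathcal{W}$. A $(G,(H_w)_{w\in\mathcal{W}})$-function is a tuple $(\alpha_w)_{w\in\mathcal{W}}$ of functions $\alpha_w\colon G\to H_w$; a $(G,(H_w)_{w\in\mathcal{W}})$-property is any property of such tuples (i.e., a subset of the set of such tuples). Such a property $P$ is expressible if there exist $M\ge0$, integers $J_1,\dots,J_M\ge 0$, elements $h_{i,j}\in G$ and sets $E_{i,j}\subset\prod_{w\in\mathcal{W}}H_w$ ($1\le i\le M$, $1\le j\le J_i$) such that a tuple satisfies $P$ if and only if for every $i$ and every $x\in G$ the sets $(\alpha_w(x+h_{i,j}))_{w\in\mathcal{W}}+E_{i,j}$, $j=1,\dots,J_i$, are pairwise disjoint with union $\prod_{w\in\mathcal{W}}H_w$. $P$ is weakly expressible if there exist a finite set $\mathcal{W}_0$ disjoint from $\mathcal{W}$, finite abelian groups $H_w$ for $w\in\mathcal{W}_0$, and an expressible $(G,(H_w)_{w\in\mathcal{W}\uplus\mathcal{W}_0})$-property $P^*$ such that $(\alpha_w)_{w\in\mathcal{W}}$ satisfies $P$ if and only if it can be extended to a tuple $(\alpha_w)_{w\in\mathcal{W}\uplus\mathcal{W}_0}$ satisfying $P^*$.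 A function $\alpha\colon G\to H$ is periodic if it is invariant under translation by some finite-index subgroup of $G$. A property $P$ is aperiodic if at least one tuple satisfies $P$, and every tuple satisfying $P$ has at least one non-periodic component $\alpha_w$. -}

module Defs where

open import Level using (0ℓ)
open import Data.Nat using (ℕ)
open import Data.Fin using (Fin)
open import Data.Integer as ℤ using (ℤ)
open import Data.Product using (Σ; Σ-syntax; _×_; _,_)
open import Data.Sum using (_⊎_; inj₁; inj₂)
open import Relation.Nullary using (¬_)
open import Relation.Binary.PropositionalEquality using (_≡_; _≢_)
open import Algebra.Core using (Op₁; Op₂)
import Algebra.Structures as S
open import Function.Bundles using (_↔_; _⇔_)

record FinAbGroup : Set₁ where
  field
    Carrier : Set
    _+_ : Op₂ Carrier
    0# : Carrier
    -_ : Op₁ Carrier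
    isAbelianGroup : S.IsAbelianGroup _≡_ _+_ 0# -_
    size : ℕ
    enum : Carrier ↔ Fin size

-- The group operations of the ambient group G (only the operations are
-- needed to state the definitions).
record AbGroupOps : Set₁ where
  field
    Carrier : Set
    _+_ : Op₂ Carrier
    0# : Carrier
    -_ : Op₁ Carrier

ℤ²× : FinAbGroup → AbGroupOps
ℤ²× G1 = record
  { Carrier = ℤ × ℤ × FinAbGroup.Carrier G1
  ; _+_ = λ { (a , b , c) (a' , b' , c') →
              (a ℤ.+ a') , (b ℤ.+ b') , FinAbGroup._+_ G1 c c' }
  ; 0# = ℤ.0ℤ , ℤ.0ℤ , FinAbGroup.0# G1
  ; -_ = λ { (a , b , c) → ℤ.- a , ℤ.- b , FinAbGroup.-_ G1 c }
  }

module _ (G : AbGroupOps) {W : Set} (H : W → FinAbGroup) where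
  open AbGroupOps G

  Prod : Set
  Prod = (w : W) → FinAbGroup.Carrier (H w)

  Tuple : Set
  Tuple = (w : W) → Carrier → FinAbGroup.Carrier (H w)

  Property : Set₁
  Property = Tuple → Set

  _∈_+ₛ_ : Prod → Prod → (Prod → Set) → Set
  y ∈ a +ₛ E = Σ[ e ∈ Prod ] (E e × (∀ w → y w ≡ FinAbGroup._+_ (H w) (a w) (e w)))

  Partition : (J : ℕ) → (Fin J → Prod) → (Fin J → Prod → Set) → Set
  Partition J a E =
    (∀ (y : Prod) → Σ[ j ∈ Fin J ] (y ∈ a j +ₛ E j))
    × (∀ (j j' : Fin J) → j ≢ j' → ∀ (y : Prod) → ¬ ((y ∈ a j +ₛ E j) × (y ∈ a j' +ₛ E j')))

  Expressible : Property → Set₁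
  Expressible P =
    Σ[ M ∈ ℕ ] Σ[ J ∈ (Fin M → ℕ) ]
    Σ[ h ∈ ((i : Fin M) → Fin (J i) → Carrier) ]
    Σ[ E ∈ ((i : Fin M) → Fin (J i) → Prod → Set) ]
      (∀ (α : Tuple) → P α ⇔
        (∀ (i : Fin M) (x : Carrier) →
           Partition (J i) (λ j w → α w (x + h i j)) (E i)))

[_,_]ᴴ : {W W₀ : Set} → (W → FinAbGroup) → (W₀ → FinAbGroup) → W ⊎ W₀ → FinAbGroup
[ H , H₀ ]ᴴ (inj₁ w) = H w
[ H , H₀ ]ᴴ (inj₂ v) = H₀ v

module _ (G : AbGroupOps) {W : Set} (H : W → FinAbGroup) where
  open AbGroupOps G

  WeaklyExpressible : Property G H → Set₁
  WeaklyExpressible P =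
    Σ[ k₀ ∈ ℕ ] Σ[ H₀ ∈ (Fin k₀ → FinAbGroup) ]
    Σ[ P* ∈ Property G [ H , H₀ ]ᴴ ]
      (Expressible G [ H , H₀ ]ᴴ P*
       × (∀ (α : Tuple G H) → P α ⇔
            (Σ[ γ ∈ Tuple G [ H , H₀ ]ᴴ ]
               ((∀ w x → γ (inj₁ w) x ≡ α w x) × P* γ))))

module _ (G : AbGroupOps) where
  open AbGroupOps G

  record Subgroup : Set₁ where
    field
      mem : Carrier → Set
      0-mem : mem 0#
      +-mem : ∀ {x y} → mem x → mem y → mem (x + y)
      neg-mem : ∀ {x} → mem x → mem (- x)

  FiniteIndex : Subgroup → Set
  FiniteIndex S =
    Σ[ n ∈ ℕ ] Σ[ r ∈ (Fin n → Carrier) ]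
      (∀ x → Σ[ i ∈ Fin n ] Σ[ s ∈ Carrier ] (Subgroup.mem S s × x ≡ r i + s))

  Periodic : {A : Set} → (Carrier → A) → Set₁
  Periodic f = Σ[ S ∈ Subgroup ] (FiniteIndex S
                 × (∀ s → Subgroup.mem S s → ∀ x → f (x + s) ≡ f x))

  Aperiodic : {W : Set} {H : W → FinAbGroup} → Property G H → Set₁
  Aperiodic {W} {H} P =
    (Σ[ α ∈ Tuple G H ] P α)
    × (∀ (α : Tuple G H) → P α → Σ[ w ∈ W ] ¬ Periodic (α w))

{-# OPTIONS --safe #-}

-- The property concerns ten columns, i.e. bits F r τ (i + (2τ + r) j) that are constant along
-- lines of ten different slopes in ℤ², and a bit B j.  It requires that at every (i , j) these
-- look, to the precision of Alt and Mixed below, like the parities of the 2-adic valuations of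
-- the ten linear forms and of j, in a way compatible with the parities of i and j.
-- The rule is scale invariant: restricting a solution to a suitable coset of (2ℤ)² gives a
-- solution again.  A common period of the columns must be even and is halved by this
-- restriction, so there is none.
--
-- To express such pointwise constraints, the bits at (i , j) are stored as the slope vector b
-- of an affine function on an elementary abelian 2-group contained in G₁.  A partition into two
-- translates says that a homomorphic image of α changes by a constant under a translation.
-- A vector ε is avoided by b iff k ↦ (b + ε) ∙ k is balanced, i.e. iff it is the first
-- component of a bijection; this is a partition into singletons modulo a subgroup, the second
-- component being an auxiliary function.  A bit that has to alternate along ℤ² is obtained by
-- comparing two ℤ/4-valued functions that change by ±1 under an element of order 2.

module Submission where

open import Defs
open import Data.Bool using (Bool; true; false; not; _xor_; _∧_)
open import Data.Bool.Properties using (not-involutive; not-¬; xor-assoc; xor-comm; xor-same; xor-identityˡ; xor-identityʳ; ∧-distribˡ-xor)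
  renaming (_≟_ to _≟ᵇ_)
open import Data.Empty using (⊥; ⊥-elim)
open import Data.Fin using (Fin; zero; suc; toℕ; #_; _↑ˡ_; _↑ʳ_; splitAt)
open import Data.Fin.Patterns using (0F; 1F; 2F; 3F; 4F)
open import Data.Fin.Properties using (all?; pigeonhole; 2↔Bool; *↔×; splitAt-↑ˡ; splitAt-↑ʳ) renaming (_≟_ to _≟ᶠ_)
open import Data.Integer.Tactic.RingSolver using (solve-∀)
open import Data.Nat using (ℕ)
open import Data.Product using (Σ-syntax; _×_; _,_; proj₁; proj₂)
open import Data.Sum using (_⊎_; inj₁; inj₂; [_,_]; [_,_]′)
open import Data.Unit using (⊤; tt)
open import Relation.Nullary using (Dec; yes; no; ¬_; contradiction)
open import Relation.Nullary.Decidable using (toWitness; map′; decidable-stable; _×-dec_; _⊎-dec_; _→-dec_)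
open import Relation.Binary.PropositionalEquality using (_≡_; _≢_; refl; sym; trans; cong; cong₂; subst; subst₂; isEquivalence)
import Data.Nat as ℕ
import Data.Nat.Properties as ℕ

-- For odd `j`, one of the two families of slopes (even ones, odd ones) takes odd values on a row
-- and the other takes values `2 (A + τ j)`; this is why ten slopes come as twice five. The
-- difficulty lies in the descent. On the even sublattice only the disjunction `Ruled` is inherited,
-- together with `Alt` for each halved family along all lines of odd step. Which parity class of
-- places carries the constant value, and which rows are not constant, must be recovered from this
-- alone. Within a family either all five columns agree on such a class, or the columns whose index
-- has one parity never take the value `κ`. A single family cannot exclude the second case; it is
-- refuted by playing the two families against each other, and this is what the bit `B` serves for:
-- it ties the value of the constant family to `j`, independently of `i`.

module ValuationSudoku where
  open import Data.Integer using (ℤ; +_; -[1+_]; _+_; _*_; _-_; -_; ∣_∣)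
  open import Data.Integer.DivMod using (_%ℕ_; _/ℕ_; n%ℕd<d; a≡a%ℕn+[a/ℕn]*n)
  open import Data.Integer.Properties using (_≟_; pos-+; pos-*; abs-*; ∣i∣≡0⇒i≡0; *-cancelˡ-≡)
  open import Data.Nat using (z≤n; s≤s)
  open import Induction.WellFounded using (Acc; acc)
  import Data.Nat.DivMod as ℕ

  -- The local rule for rows of ten bits

  odd : ℤ → ℤ
  odd m = + 1 + + 2 * m

  even : ℤ → ℤ
  even m = + 2 * m

  ⟦_⟧ : Bool → ℤ
  ⟦ false ⟧ = + 0
  ⟦ true ⟧ = + 1

  pos : Fin 5 → ℤ
  pos τ = + toℕ τ

  form : Bool → Fin 5 → ℤ → ℤ → ℤ
  form r τ i j = i + (+ 2 * pos τ + ⟦ r ⟧) * j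

  -- What is required of z τ as the parity of v₂(A + τ j), 0 ≤ τ ≤ 4, for odd j, when not κ
  -- stands for even: the τ of one parity give valuation 0, and among the other τ those of
  -- one class modulo 4 give valuation 1.
  Alt : Bool → (Fin 5 → Bool) → Set
  Alt κ z =
      (z 1F ≡ not κ × z 3F ≡ not κ × ((z 0F ≡ κ × z 4F ≡ κ) ⊎ z 2F ≡ κ))
    ⊎ (z 0F ≡ not κ × z 2F ≡ not κ × z 4F ≡ not κ × (z 1F ≡ κ ⊎ z 3F ≡ κ))

  Row : Set
  Row = Bool → Fin 5 → Bool

  Const : Row → Set
  Const f = ∀ r τ → f r τ ≡ f false 0F

  -- The shape of a row whose step j has valuation at most that of i; b is the parity of v₂(j).
  Mixed : Bool → Row → Set
  Mixed b f = Σ[ r ∈ Bool ] ((∀ τ → f r τ ≡ b) × Alt b (f (not r)))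

  clash : ∀ {A : Set} {x κ} → x ≡ κ → x ≡ not κ → A
  clash p q = contradiction (trans (sym p) q) (not-¬ refl)

  ≢⇒≡not : ∀ {x κ} → x ≢ κ → x ≡ not κ
  ≢⇒≡not {false} {false} n = contradiction refl n
  ≢⇒≡not {false} {true}  n = refl
  ≢⇒≡not {true}  {false} n = refl
  ≢⇒≡not {true}  {true}  n = contradiction refl n

  dichotomy : ∀ x κ → x ≡ κ ⊎ x ≡ not κ
  dichotomy false false = inj₁ refl
  dichotomy false true  = inj₂ refl
  dichotomy true  false = inj₂ refl
  dichotomy true  true  = inj₁ refl

  Alt-cong : ∀ {κ} {z z′ : Fin 5 → Bool} → (∀ τ → z τ ≡ z′ τ) → Alt κ z → Alt κ z′
  Alt-cong e (inj₁ (a , b , inj₁ (c , d))) =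
    inj₁ (trans (sym (e _)) a , trans (sym (e _)) b , inj₁ (trans (sym (e _)) c , trans (sym (e _)) d))
  Alt-cong e (inj₁ (a , b , inj₂ c)) =
    inj₁ (trans (sym (e _)) a , trans (sym (e _)) b , inj₂ (trans (sym (e _)) c))
  Alt-cong e (inj₂ (a , b , c , inj₁ d)) =
    inj₂ (trans (sym (e _)) a , trans (sym (e _)) b , trans (sym (e _)) c , inj₁ (trans (sym (e _)) d))
  Alt-cong e (inj₂ (a , b , c , inj₂ d)) =
    inj₂ (trans (sym (e _)) a , trans (sym (e _)) b , trans (sym (e _)) c , inj₂ (trans (sym (e _)) d))

  Const-cong : ∀ {f g : Row} → (∀ r τ → f r τ ≡ g r τ) → Const f → Const g
  Const-cong e c r τ = trans (sym (e r τ)) (trans (c r τ) (e false 0F))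

  Mixed-cong : ∀ {b c} {f g : Row} → b ≡ c → (∀ r τ → f r τ ≡ g r τ) → Mixed b f → Mixed c g
  Mixed-cong refl e (r , p , a) = r , (λ τ → trans (sym (e r τ)) (p τ)) , Alt-cong (e (not r)) a

  Rule-cong : ∀ {b c} {f g : Row} → b ≡ c → (∀ r τ → f r τ ≡ g r τ) → Const f ⊎ Mixed b f → Const g ⊎ Mixed c g
  Rule-cong _ e (inj₁ p) = inj₁ (Const-cong e p)
  Rule-cong q e (inj₂ p) = inj₂ (Mixed-cong q e p)

  Alt-nonconst : ∀ {κ z} c → (∀ τ → z τ ≡ c) → ¬ Alt κ z
  Alt-nonconst c e (inj₁ (a , _ , inj₁ (d , _))) = clash d (trans (e 0F) (trans (sym (e 1F)) a))
  Alt-nonconst c e (inj₁ (a , _ , inj₂ d)) = clash d (trans (e 2F) (trans (sym (e 1F)) a))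
  Alt-nonconst c e (inj₂ (a , _ , _ , inj₁ d)) = clash d (trans (e 1F) (trans (sym (e 0F)) a))
  Alt-nonconst c e (inj₂ (a , _ , _ , inj₂ d)) = clash d (trans (e 3F) (trans (sym (e 0F)) a))

  Mixed⇒¬Const : ∀ {b f} → Mixed b f → ¬ Const f
  Mixed⇒¬Const (r , _ , a) c = Alt-nonconst _ (c (not r)) a

  isEven : Fin 5 → Bool
  isEven 0F = true
  isEven 1F = false
  isEven 2F = true
  isEven 3F = false
  isEven 4F = true

  -- Each alternative gives `not κ` to all columns of one parity; a `κ` at `τ₀` rules out the
  -- alternative that does so for the parity of `τ₀`.
  Alt-opposite : ∀ {κ z} → Alt κ z → ∀ τ₀ τ₁ → isEven τ₁ ≡ not (isEven τ₀) → z τ₀ ≡ κ → z τ₁ ≡ not κ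
  Alt-opposite (inj₁ (a , b , _)) 0F 1F _ _ = a
  Alt-opposite (inj₁ (a , b , _)) 0F 3F _ _ = b
  Alt-opposite (inj₁ (a , b , _)) 0F 4F () _
  Alt-opposite (inj₁ (a , b , _)) 2F 1F _ _ = a
  Alt-opposite (inj₁ (a , b , _)) 2F 3F _ _ = b
  Alt-opposite (inj₁ (a , b , _)) 2F 4F () _
  Alt-opposite (inj₁ (a , b , _)) 4F 1F _ _ = a
  Alt-opposite (inj₁ (a , b , _)) 4F 3F _ _ = b
  Alt-opposite (inj₁ (a , b , _)) 4F 4F () _
  Alt-opposite (inj₁ (a , b , _)) 1F _ _ p = clash p a
  Alt-opposite (inj₁ (a , b , _)) 3F _ _ p = clash p b
  Alt-opposite (inj₂ (a , b , c , _)) 0F _ _ p = clash p a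
  Alt-opposite (inj₂ (a , b , c , _)) 2F _ _ p = clash p b
  Alt-opposite (inj₂ (a , b , c , _)) 4F _ _ p = clash p c
  Alt-opposite (inj₂ (a , b , c , _)) 1F 0F _ _ = a
  Alt-opposite (inj₂ (a , b , c , _)) 1F 2F _ _ = b
  Alt-opposite (inj₂ (a , b , c , _)) 1F 4F _ _ = c
  Alt-opposite (inj₂ (a , b , c , _)) 3F 0F _ _ = a
  Alt-opposite (inj₂ (a , b , c , _)) 3F 2F _ _ = b
  Alt-opposite (inj₂ (a , b , c , _)) 3F 4F _ _ = c

  -- Five columns of one family along lines of odd step

  Family : Set
  Family = Fin 5 → ℤ → Bool

  record AltRows (κ : Bool) (g : Family) : Set where
    constructor altRows
    field alternate : ∀ A m → Alt κ (λ τ → g τ (A + pos τ * odd m))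

  open AltRows public

  module _ {κ : Bool} {g : Family} (alt : AltRows κ g) where

    row : ∀ A m (x : Fin 5 → ℤ) → (∀ τ → A + pos τ * odd m ≡ x τ) → Alt κ (λ τ → g τ (x τ))
    row A m x e = Alt-cong (λ τ → cong (g τ) (e τ)) (alternate alt A m)

    through : ∀ τ₀ n m → Alt κ (λ τ → g τ (n + (pos τ - pos τ₀) * odd m))
    through τ₀ n m = row (n - pos τ₀ * odd m) m _ (λ τ → eq (pos τ) (pos τ₀) n m)
      where eq : ∀ a b n m → n - b * (+ 1 + + 2 * m) + a * (+ 1 + + 2 * m) ≡ n + (a - b) * (+ 1 + + 2 * m)
            eq = solve-∀

    through-self : ∀ τ₀ n m → g τ₀ (n + (pos τ₀ - pos τ₀) * odd m) ≡ g τ₀ n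
    through-self τ₀ n m = cong (g τ₀) (eq (pos τ₀) n m)
      where eq : ∀ b n m → n + (b - b) * (+ 1 + + 2 * m) ≡ n
            eq = solve-∀

    linked : ∀ τ₀ τ₁ n m → isEven τ₁ ≡ not (isEven τ₀) → g τ₀ n ≡ κ →
             g τ₁ (n + (pos τ₁ - pos τ₀) * odd m) ≡ not κ
    linked τ₀ τ₁ n m opp z =
      Alt-opposite (through τ₀ n m) τ₀ τ₁ opp (trans (through-self τ₀ n m) z)

    -- Between adjacent columns the displacement is the step of the row itself, hence an arbitrary
    -- odd number. Columns three apart yield only multiples of three in this way and need a separate
    -- argument.
    right : ∀ τ₀ τ₁ → pos τ₁ ≡ pos τ₀ + + 1 → isEven τ₁ ≡ not (isEven τ₀) →
            ∀ n m → g τ₀ n ≡ κ → g τ₁ (n + odd m) ≡ not κ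
    right τ₀ τ₁ e opp n m z = trans (cong (g τ₁) eq) (linked τ₀ τ₁ n m opp z)
      where solved : ∀ a n m → n + (+ 1 + + 2 * m) ≡ n + (a + + 1 - a) * (+ 1 + + 2 * m)
            solved = solve-∀
            eq : n + odd m ≡ n + (pos τ₁ - pos τ₀) * odd m
            eq = trans (solved (pos τ₀) n m) (cong (λ a → n + (a - pos τ₀) * odd m) (sym e))

    left : ∀ τ₀ τ₁ → pos τ₀ ≡ pos τ₁ + + 1 → isEven τ₁ ≡ not (isEven τ₀) →
           ∀ n m → g τ₀ n ≡ κ → g τ₁ (n + odd m) ≡ not κ
    -- `odd (- m - + 1)` is `- odd m`: the row is run through backwards.
    left τ₀ τ₁ e opp n m z = trans (cong (g τ₁) eq) (linked τ₀ τ₁ n (- m - + 1) opp z)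
      where solved : ∀ a n m → n + (+ 1 + + 2 * m) ≡ n + (a - (a + + 1)) * (+ 1 + + 2 * (- m - + 1))
            solved = solve-∀
            eq : n + odd m ≡ n + (pos τ₁ - pos τ₀) * odd (- m - + 1)
            eq = trans (solved (pos τ₁) n m) (cong (λ a → n + (pos τ₁ - a) * odd (- m - + 1)) (sym e))

    back : ∀ τ {n m} → g τ (n + odd m + odd (- m - + 1)) ≡ not κ → g τ n ≡ not κ
    back τ {n} {m} = trans (cong (g τ) (eq n m))
      where eq : ∀ n m → n ≡ n + (+ 1 + + 2 * m) + (+ 1 + + 2 * (- m - + 1))
            eq = solve-∀

    -- Zeros in columns 0 and 3 (or 4 and 1) would force ones at 2 and 4 (or 0 and 2), but a
    -- zero in column 0 (or 4) needs another zero there: the reason for having a fifth column.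
    far₀₃ : ∀ n m → g 0F n ≡ κ → g 3F (n + odd m) ≡ not κ
    far₀₃ n m z = ≢⇒≡not λ z′ → go z′ (through 0F n m)
      where
      go : g 3F (n + odd m) ≡ κ → Alt κ (λ τ → g τ (n + (pos τ - pos 0F) * odd m)) → ⊥
      go z′ (inj₂ (a , _)) = clash z (trans (sym (through-self 0F n m)) a)
      -- The place of column 4 lies `4 * odd m` beyond `n`, hence `3 * odd m` beyond the `κ` of
      -- column 3; `3 * odd m` is `odd (m + m + m + + 1)`.
      go z′ (inj₁ (_ , _ , inj₁ (_ , c))) = clash c
        (trans (cong (g 4F) (eq n m)) (right 3F 4F refl refl (n + odd m) (m + m + m + + 1) z′))
        where eq : ∀ n m → n + (+ 4 - + 0) * (+ 1 + + 2 * m) ≡ n + (+ 1 + + 2 * m) + (+ 1 + + 2 * (m + m + m + + 1))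
              eq = solve-∀
      go z′ (inj₁ (_ , _ , inj₂ c)) = clash c
        (trans (cong (g 2F) (eq n m)) (left 3F 2F refl refl (n + odd m) m z′))
        where eq : ∀ n m → n + (+ 2 - + 0) * (+ 1 + + 2 * m) ≡ n + (+ 1 + + 2 * m) + (+ 1 + + 2 * m)
              eq = solve-∀

    far₄₁ : ∀ n m → g 4F n ≡ κ → g 1F (n + odd m) ≡ not κ
    far₄₁ n m z = ≢⇒≡not λ z′ → go z′ (through 4F n m)
      where
      go : g 1F (n + odd m) ≡ κ → Alt κ (λ τ → g τ (n + (pos τ - pos 4F) * odd m)) → ⊥
      go z′ (inj₂ (_ , _ , a , _)) = clash z (trans (sym (through-self 4F n m)) a)
      go z′ (inj₁ (_ , _ , inj₁ (c , _))) = clash c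
        (trans (cong (g 0F) (eq n m)) (left 1F 0F refl refl (n + odd m) (- (+ 5 * m) - + 3) z′))
        where eq : ∀ n m → n + (+ 0 - + 4) * (+ 1 + + 2 * m) ≡ n + (+ 1 + + 2 * m) + (+ 1 + + 2 * (- (+ 5 * m) - + 3))
              eq = solve-∀
      go z′ (inj₁ (_ , _ , inj₂ c)) = clash c
        (trans (cong (g 2F) (eq n m)) (right 1F 2F refl refl (n + odd m) (- (+ 3 * m) - + 2) z′))
        where eq : ∀ n m → n + (+ 2 - + 4) * (+ 1 + + 2 * m) ≡ n + (+ 1 + + 2 * m) + (+ 1 + + 2 * (- (+ 3 * m) - + 2))
              eq = solve-∀

    -- Contrapositive of `far₀₃`, since the displacement back is again odd.
    far₃₀ : ∀ n m → g 3F n ≡ κ → g 0F (n + odd m) ≡ not κ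
    far₃₀ n m z = ≢⇒≡not λ z′ → clash z (back 3F {n} {m} (far₀₃ (n + odd m) (- m - + 1) z′))

    far₁₄ : ∀ n m → g 1F n ≡ κ → g 4F (n + odd m) ≡ not κ
    far₁₄ n m z = ≢⇒≡not λ z′ → clash z (back 1F {n} {m} (far₄₁ (n + odd m) (- m - + 1) z′))

    opposite : ∀ τ₀ τ₁ → isEven τ₁ ≡ not (isEven τ₀) → ∀ n m → g τ₀ n ≡ κ → g τ₁ (n + odd m) ≡ not κ
    opposite 0F 1F o = right 0F 1F refl o
    opposite 0F 3F _ = far₀₃
    opposite 0F 4F ()
    opposite 2F 1F o = left 2F 1F refl o
    opposite 2F 3F o = right 2F 3F refl o
    opposite 2F 4F ()
    opposite 4F 1F _ = far₄₁
    opposite 4F 3F o = left 4F 3F refl o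
    opposite 4F 4F ()
    opposite 1F 0F o = left 1F 0F refl o
    opposite 1F 2F o = right 1F 2F refl o
    opposite 1F 4F _ = far₁₄
    opposite 3F 0F _ = far₃₀
    opposite 3F 2F o = left 3F 2F refl o
    opposite 3F 4F o = right 3F 4F refl o

  parity : ∀ n → (Σ[ m ∈ ℤ ] n ≡ even m) ⊎ (Σ[ m ∈ ℤ ] n ≡ odd m)
  parity n with n %ℕ 2 | n%ℕd<d n 2 | a≡a%ℕn+[a/ℕn]*n n 2
  ... | 0 | _ | e = inj₁ (n /ℕ 2 , trans e (eq (n /ℕ 2)))
    where eq : ∀ q → + 0 + q * + 2 ≡ + 2 * q
          eq = solve-∀
  ... | 1 | _ | e = inj₂ (n /ℕ 2 , trans e (eq (n /ℕ 2)))
    where eq : ∀ q → + 1 + q * + 2 ≡ + 1 + + 2 * q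
          eq = solve-∀
  ... | ℕ.suc (ℕ.suc _) | ℕ.s≤s (ℕ.s≤s ()) | _

  -- `AltRows` alone does not exclude `twisted`: let column 2 be `κ` everywhere and the other
  -- columns `not κ`. Of the columns without any `κ`, one witness `τ*` is recorded.
  data Shape (κ : Bool) (g : Family) : Set where
    normal  : ∀ o → (∀ τ m → g τ (odd m + ⟦ o ⟧) ≡ not κ) → Shape κ g
    twisted : ∀ τ₀ a → g τ₀ (even a) ≡ κ → ∀ τ₁ b → g τ₁ (odd b) ≡ κ →
              ∀ τ* → (∀ n → g τ* n ≡ not κ) → Shape κ g

  module _ {κ : Bool} {g : Family} (alt : AltRows κ g) where

    from-even : ∀ {τ₀ τ} a → g τ₀ (even a) ≡ κ → isEven τ ≡ not (isEven τ₀) → ∀ m → g τ (odd m) ≡ not κ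
    from-even {τ₀} {τ} a z opp m = trans (cong (g τ) (eq a m)) (opposite alt τ₀ τ opp (even a) (m - a) z)
      where eq : ∀ a m → + 1 + + 2 * m ≡ + 2 * a + (+ 1 + + 2 * (m - a))
            eq = solve-∀

    from-odd : ∀ {τ₀ τ} b → g τ₀ (odd b) ≡ κ → isEven τ ≡ not (isEven τ₀) → ∀ m → g τ (even m) ≡ not κ
    from-odd {τ₀} {τ} b z opp m = trans (cong (g τ) (eq b m)) (opposite alt τ₀ τ opp (odd b) (m - b - + 1) z)
      where eq : ∀ b m → + 2 * m ≡ + 1 + + 2 * b + (+ 1 + + 2 * (m - b - + 1))
            eq = solve-∀

    -- In the row with `A = 0` and step 1 the place equals the column index, so the `κ` that `Alt`
    -- provides has column and place of equal parity. In `phase₁` the place is one larger and the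
    -- parities differ.
    phase₀ : (Σ[ τ₀ ∈ Fin 5 ] Σ[ a ∈ ℤ ] (isEven τ₀ ≡ true × g τ₀ (even a) ≡ κ))
           ⊎ (Σ[ τ₀ ∈ Fin 5 ] Σ[ b ∈ ℤ ] (isEven τ₀ ≡ false × g τ₀ (odd b) ≡ κ))
    phase₀ with alternate alt (+ 0) (+ 0)
    ... | inj₁ (_ , _ , inj₁ (z , _))     = inj₁ (0F , + 0 , refl , z)
    ... | inj₁ (_ , _ , inj₂ z)           = inj₁ (2F , + 1 , refl , z)
    ... | inj₂ (_ , _ , _ , inj₁ z)       = inj₂ (1F , + 0 , refl , z)
    ... | inj₂ (_ , _ , _ , inj₂ z)       = inj₂ (3F , + 1 , refl , z)

    phase₁ : (Σ[ τ₀ ∈ Fin 5 ] Σ[ b ∈ ℤ ] (isEven τ₀ ≡ true × g τ₀ (odd b) ≡ κ))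
           ⊎ (Σ[ τ₀ ∈ Fin 5 ] Σ[ a ∈ ℤ ] (isEven τ₀ ≡ false × g τ₀ (even a) ≡ κ))
    phase₁ with alternate alt (+ 1) (+ 0)
    ... | inj₁ (_ , _ , inj₁ (z , _))     = inj₁ (0F , + 0 , refl , z)
    ... | inj₁ (_ , _ , inj₂ z)           = inj₁ (2F , + 1 , refl , z)
    ... | inj₂ (_ , _ , _ , inj₁ z)       = inj₂ (1F , + 1 , refl , z)
    ... | inj₂ (_ , _ , _ , inj₂ z)       = inj₂ (3F , + 2 , refl , z)

    everywhere : ∀ τ → (∀ m → g τ (even m) ≡ not κ) → (∀ m → g τ (odd m) ≡ not κ) → ∀ n → g τ n ≡ not κ
    everywhere τ e o n with parity n
    ... | inj₁ (m , refl) = e m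
    ... | inj₂ (m , refl) = o m

    -- The `κ`s of `phase₀` and `phase₁` are fed to `opposite`. If their columns have equal parity,
    -- their places have both parities and no `κ` is left in the columns of the other parity. If
    -- their columns differ in parity, their places share one, and all columns are `not κ` on the
    -- other class of places.
    shape : Shape κ g
    shape with phase₀ | phase₁
    ... | inj₁ (τ₀ , a , p₀ , z₀) | inj₁ (τ₁ , b , p₁ , z₁) =
      twisted τ₀ a z₀ τ₁ b z₁ 1F
        (everywhere 1F (from-odd b z₁ (cong not (sym p₁))) (from-even a z₀ (cong not (sym p₀))))
    ... | inj₂ (τ₁ , b , p₁ , z₁) | inj₂ (τ₀ , a , p₀ , z₀) =
      twisted τ₀ a z₀ τ₁ b z₁ 0F
        (everywhere 0F (from-odd b z₁ (cong not (sym p₁))) (from-even a z₀ (cong not (sym p₀))))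
    ... | inj₁ (τ₀ , a , p₀ , z₀) | inj₂ (τ₁ , b , p₁ , z₁) = normal false ones
      where
      ones : ∀ τ m → g τ (odd m + + 0) ≡ not κ
      ones τ m = trans (cong (g τ) (eq m)) (pick τ)
        where
        eq : ∀ m → + 1 + + 2 * m + + 0 ≡ + 1 + + 2 * m
        eq = solve-∀
        pick : ∀ τ → g τ (odd m) ≡ not κ
        pick τ with dichotomy (isEven τ) true
        ... | inj₁ e = from-even b z₁ (trans e (cong not (sym p₁))) m
        ... | inj₂ e = from-even a z₀ (trans e (cong not (sym p₀))) m
    ... | inj₂ (τ₀ , a , p₀ , z₀) | inj₁ (τ₁ , b , p₁ , z₁) = normal true ones
      where
      ones : ∀ τ m → g τ (odd m + + 1) ≡ not κ
      ones τ m = trans (cong (g τ) (eq m)) (pick τ)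
        where
        eq : ∀ m → + 1 + + 2 * m + + 1 ≡ + 2 * (m + + 1)
        eq = solve-∀
        pick : ∀ τ → g τ (even (m + + 1)) ≡ not κ
        pick τ with dichotomy (isEven τ) true
        ... | inj₁ e = from-odd a z₀ (trans e (cong not (sym p₀))) (m + + 1)
        ... | inj₂ e = from-odd b z₁ (trans e (cong not (sym p₁))) (m + + 1)

  -- Interplay of the two families and exclusion of the twisted shape

  Columns : Set
  Columns = Bool → Family

  rowOf : Columns → ℤ → ℤ → Row
  rowOf F i j r τ = F r τ (form r τ i j)

  Ruled : Columns → (ℤ → Bool) → Set
  Ruled F B = ∀ i j → Const (rowOf F i j) ⊎ Mixed (B j) (rowOf F i j)

  coeff : Bool → Fin 5 → ℤ
  coeff r τ = + 2 * pos τ + ⟦ r ⟧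

  divide : ℤ → ℤ
  divide (+ 0) = + 0
  divide (+ ℕ.suc n) = + (315 ℕ./ ℕ.suc n)
  divide -[1+ n ] = - + (315 ℕ./ ℕ.suc n)

  -- Differences of coefficients of opposite parity are odd and at most 9 in
  -- absolute value, hence divide 315.
  divides-315 : ∀ r τ τ₀ → (coeff (not r) τ - coeff r τ₀) * divide (coeff (not r) τ - coeff r τ₀) ≡ + 315
  divides-315 false = toWitness {a? = all? λ τ → all? λ τ₀ → _ ≟ _} tt
  divides-315 true  = toWitness {a? = all? λ τ → all? λ τ₀ → _ ≟ _} tt

  ⟦not⟧ : ∀ r → ⟦ not r ⟧ ≡ + 1 - ⟦ r ⟧
  ⟦not⟧ false = refl
  ⟦not⟧ true  = refl

  module _ {κ : Bool} {G : Columns} {B : ℤ → Bool} (alt : ∀ r → AltRows κ (G r)) (any : Ruled G B) where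

    module Twisted (r : Bool) (τ* : Fin 5) (ones : ∀ n → G r τ* n ≡ not κ) where

      -- A row through a `κ` of family `r` also meets column `τ*`, so family `r` is not constant on
      -- it. The rule then leaves only `Mixed` with `not r` as the constant family, whose value is
      -- `B j`.
      forced : ∀ τ₀ n → G r τ₀ n ≡ κ → ∀ τ j → G (not r) τ (n + (coeff (not r) τ - coeff r τ₀) * j) ≡ B j
      forced τ₀ n z τ j = trans (cong (G (not r) τ) (eq (coeff (not r) τ) (coeff r τ₀) n j)) (go (any i j))
        where
        i = n - coeff r τ₀ * j
        eq : ∀ c d n j → n + (c - d) * j ≡ n - d * j + c * j
        eq = solve-∀
        eq₀ : ∀ c n j → n - c * j + c * j ≡ n
        eq₀ = solve-∀
        z′ : rowOf G i j r τ₀ ≡ κ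
        z′ = trans (cong (G r τ₀) (eq₀ (coeff r τ₀) n j)) z
        go : Const (rowOf G i j) ⊎ Mixed (B j) (rowOf G i j) → rowOf G i j (not r) τ ≡ B j
        go (inj₁ c) = clash z′ (trans (c r τ₀) (trans (sym (c r τ*)) (ones _)))
        go (inj₂ (r′ , c , _)) with dichotomy r′ r
        ... | inj₁ refl = clash z′ (trans (c τ₀) (trans (sym (c τ*)) (ones _)))
        ... | inj₂ refl = c τ

      module _ {τ₀ a} (z₀ : G r τ₀ (even a) ≡ κ) {τ₁ b} (z₁ : G r τ₁ (odd b) ≡ κ) where

        -- By `forced`, `B j` is a value of the other family. If that family is twisted, its column
        -- without `κ` is read off. If it is normal, column 0 is read at an odd multiple of `j` from
        -- a known `κ`; since `κ` occurs at places of both parities, one choice lands in the class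
        -- where the family is `not κ`.
        B-one : Shape κ (G (not r)) → ∀ j → B j ≡ not κ
        B-one (twisted _ _ _ _ _ _ τ* ones′) j = trans (sym (forced τ₀ (even a) z₀ τ* j)) (ones′ _)
        B-one (normal o ones′) j = go o ones′ (parity j)
          where
          via₀ : ∀ {j x} → (even a + (coeff (not r) 0F - coeff r τ₀) * j) ≡ x → G (not r) 0F x ≡ not κ → B j ≡ not κ
          via₀ {j} refl p = trans (sym (forced τ₀ (even a) z₀ 0F j)) p
          via₁ : ∀ {j x} → (odd b + (coeff (not r) 0F - coeff r τ₁) * j) ≡ x → G (not r) 0F x ≡ not κ → B j ≡ not κ
          via₁ {j} refl p = trans (sym (forced τ₁ (odd b) z₁ 0F j)) p
          w : Fin 5 → ℤ
          w τ = - (⟦ r ⟧ + pos τ)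
          gap : ∀ τ → coeff (not r) 0F - coeff r τ ≡ odd (w τ)
          gap τ = trans (cong (λ x → + 2 * pos 0F + x - coeff r τ) (⟦not⟧ r)) (eq ⟦ r ⟧ (pos τ))
            where eq : ∀ s t → + 2 * + 0 + (+ 1 - s) - (+ 2 * t + s) ≡ + 1 + + 2 * (- (s + t))
                  eq = solve-∀
          eq₁ : ∀ b w k → + 1 + + 2 * b + (+ 1 + + 2 * w) * (+ 2 * k) ≡ + 1 + + 2 * (b + (+ 1 + + 2 * w) * k) + + 0
          eq₁ = solve-∀
          eq₂ : ∀ a w k → + 2 * a + (+ 1 + + 2 * w) * (+ 1 + + 2 * k) ≡ + 1 + + 2 * (a + w + k + + 2 * w * k) + + 0
          eq₂ = solve-∀
          eq₃ : ∀ a w k → + 2 * a + (+ 1 + + 2 * w) * (+ 2 * k) ≡ + 1 + + 2 * (a + (+ 1 + + 2 * w) * k - + 1) + + 1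
          eq₃ = solve-∀
          eq₄ : ∀ b w k → + 1 + + 2 * b + (+ 1 + + 2 * w) * (+ 1 + + 2 * k) ≡ + 1 + + 2 *
              (b + w + k + + 2 * w * k) + + 1
          eq₄ = solve-∀
          go : ∀ o → (∀ τ m → G (not r) τ (odd m + ⟦ o ⟧) ≡ not κ) →
               ∀ {j} → (Σ[ m ∈ ℤ ] j ≡ even m) ⊎ (Σ[ m ∈ ℤ ] j ≡ odd m) → B j ≡ not κ
          go false ones′ (inj₁ (k , refl)) =
            via₁ (trans (cong (λ x → odd b + x * even k) (gap τ₁)) (eq₁ b (w τ₁) k)) (ones′ 0F (b + odd (w τ₁) * k))
          go false ones′ (inj₂ (k , refl)) =
            via₀ (trans (cong (λ x → even a + x * odd k) (gap τ₀)) (eq₂ a (w τ₀) k)) (ones′ 0F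
                (a + w τ₀ + k + + 2 * w τ₀ * k))
          go true ones′ (inj₁ (k , refl)) =
            via₀ (trans (cong (λ x → even a + x * even k) (gap τ₀)) (eq₃ a (w τ₀) k)) (ones′ 0F (a + odd
                (w τ₀) * k - + 1))
          go true ones′ (inj₂ (k , refl)) =
            via₁ (trans (cong (λ x → odd b + x * odd k) (gap τ₁)) (eq₄ b (w τ₁) k)) (ones′ 0F
                (b + w τ₁ + k + + 2 * w τ₁ * k))

        -- All differences of coefficients between the families divide `315`, the least common
        -- multiple of 1, 3, 5, 7, 9. Hence each entry of the row with step `315 = odd (+ 157)`
        -- starting at `even a` lies on some row through the `κ` there, and equals `not κ` by
        -- `forced` and `B-one`. But `Alt` forbids a constant row.
        impossible : ⊥
        impossible = Alt-nonconst (not κ) all-ones (row (alt (not r)) (even a) (+ 157) _ (λ τ → refl))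
          where
          d : Fin 5 → ℤ
          d τ = coeff (not r) τ - coeff r τ₀
          eq : ∀ c d q t → d * q ≡ + 315 → c + t * + 315 ≡ c + d * (q * t)
          eq c d q t e = trans (cong (λ x → c + t * x) (sym e)) (eq′ c d q t)
            where eq′ : ∀ c d q t → c + t * (d * q) ≡ c + d * (q * t)
                  eq′ = solve-∀
          all-ones : ∀ τ → G (not r) τ (even a + pos τ * odd (+ 157)) ≡ not κ
          all-ones τ = trans (cong (G (not r) τ) (eq (even a) (d τ) (divide (d τ)) (pos τ) (divides-315 r τ τ₀)))
                       (trans (forced τ₀ (even a) z₀ τ (divide (d τ) * pos τ)) (B-one (shape (alt (not r)))
                           (divide (d τ) * pos τ)))

    normal-form : ∀ r → Σ[ o ∈ Bool ] (∀ τ m → G r τ (odd m + ⟦ o ⟧) ≡ not κ)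
    normal-form r with shape (alt r)
    ... | normal o ones = o , ones
    ... | twisted τ₀ a z₀ τ₁ b z₁ τ* ones = ⊥-elim (Twisted.impossible r τ* ones {a = a} z₀ {b = b} z₁)

  -- Recovering the full rule from columns that are constant on odd places

  record Sudoku (F : Columns) (B : ℤ → Bool) : Set where
    field
      ruled     : Ruled F B
      odd-row   : ∀ i m → Mixed (B (odd m)) (rowOf F i (odd m))
      const-row : ∀ l m → Const (rowOf F (odd l) (even m))

  odd-gap : ∀ τ τ₀ → isEven τ ≡ not (isEven τ₀) → Σ[ d ∈ ℤ ] pos τ - pos τ₀ ≡ odd d
  odd-gap 0F 1F _ = -[1+ 0 ] , refl
  odd-gap 0F 3F _ = -[1+ 1 ] , refl
  odd-gap 1F 0F _ = + 0 , refl
  odd-gap 1F 2F _ = -[1+ 0 ] , refl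
  odd-gap 1F 4F _ = -[1+ 1 ] , refl
  odd-gap 2F 1F _ = + 0 , refl
  odd-gap 2F 3F _ = -[1+ 0 ] , refl
  odd-gap 3F 0F _ = + 1 , refl
  odd-gap 3F 2F _ = + 0 , refl
  odd-gap 3F 4F _ = -[1+ 0 ] , refl
  odd-gap 4F 1F _ = + 1 , refl
  odd-gap 4F 3F _ = + 0 , refl
  odd-gap 0F 0F ()
  odd-gap 0F 2F ()
  odd-gap 0F 4F ()
  odd-gap 1F 1F ()
  odd-gap 1F 3F ()
  odd-gap 2F 0F ()
  odd-gap 2F 2F ()
  odd-gap 2F 4F ()
  odd-gap 3F 1F ()
  odd-gap 3F 3F ()
  odd-gap 4F 0F ()
  odd-gap 4F 2F ()
  odd-gap 4F 4F ()

  module _ {κ : Bool} {g : Family} (alt : AltRows κ g) (ones : ∀ τ m → g τ (odd m) ≡ not κ) where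

    step : Fin 5 → Fin 5 → ℤ → ℤ → ℤ
    step τ₀ τ n m = even n + (pos τ - pos τ₀) * odd m

    one : ∀ τ₀ τ → isEven τ ≡ not (isEven τ₀) → ∀ n m → g τ (step τ₀ τ n m) ≡ not κ
    one τ₀ τ o n m with odd-gap τ τ₀ o
    ... | d , e = trans (cong (g τ) (trans (cong (λ x → even n + x * odd m) e) (eq n d m)))
                        (ones τ (n + d + m + + 2 * d * m))
      where eq : ∀ n d m → + 2 * n + (+ 1 + + 2 * d) * (+ 1 + + 2 * m) ≡ + 1 + + 2 * (n + d + m + + 2 * d * m)
            eq = solve-∀

    self : ∀ τ₀ n m → g τ₀ (even n) ≡ not κ → g τ₀ (step τ₀ τ₀ n m) ≡ not κ
    self τ₀ n m = trans (through-self alt τ₀ (even n) m)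

    -- On a row of odd step through an even place of column `τ₀`, the columns of the other parity
    -- stand at odd places and carry `not κ`. `Alt` then demands `κ` among the columns of the parity
    -- of `τ₀`; with column `τ₀` excluded by hypothesis, the remaining choice is forced. The next
    -- three lemmas argue alike.
    zero₀₂ : ∀ n m → g 0F (even n) ≡ not κ → g 2F (step 0F 2F n m) ≡ κ
    zero₀₂ n m p with through alt 0F (even n) m
    ... | inj₁ (_ , _ , inj₁ (z , _))  = clash z (self 0F n m p)
    ... | inj₁ (_ , _ , inj₂ z)        = z
    ... | inj₂ (_ , _ , _ , inj₁ z)    = clash z (one 0F 1F refl n m)
    ... | inj₂ (_ , _ , _ , inj₂ z)    = clash z (one 0F 3F refl n m)

    zero₂ : ∀ n m → g 2F (even n) ≡ not κ → g 0F (step 2F 0F n m) ≡ κ × g 4F (step 2F 4F n m) ≡ κ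
    zero₂ n m p with through alt 2F (even n) m
    ... | inj₁ (_ , _ , inj₁ zs)       = zs
    ... | inj₁ (_ , _ , inj₂ z)        = clash z (self 2F n m p)
    ... | inj₂ (_ , _ , _ , inj₁ z)    = clash z (one 2F 1F refl n m)
    ... | inj₂ (_ , _ , _ , inj₂ z)    = clash z (one 2F 3F refl n m)

    zero₁₃ : ∀ n m → g 1F (even n) ≡ not κ → g 3F (step 1F 3F n m) ≡ κ
    zero₁₃ n m p with through alt 1F (even n) m
    ... | inj₁ (_ , _ , inj₁ (z , _))  = clash z (one 1F 0F refl n m)
    ... | inj₁ (_ , _ , inj₂ z)        = clash z (one 1F 2F refl n m)
    ... | inj₂ (_ , _ , _ , inj₁ z)    = clash z (self 1F n m p)
    ... | inj₂ (_ , _ , _ , inj₂ z)    = z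

    zero₃₁ : ∀ n m → g 3F (even n) ≡ not κ → g 1F (step 3F 1F n m) ≡ κ
    zero₃₁ n m p with through alt 3F (even n) m
    ... | inj₁ (_ , _ , inj₁ (z , _))  = clash z (one 3F 0F refl n m)
    ... | inj₁ (_ , _ , inj₂ z)        = clash z (one 3F 2F refl n m)
    ... | inj₂ (_ , _ , _ , inj₁ z)    = z
    ... | inj₂ (_ , _ , _ , inj₂ z)    = clash z (self 3F n m p)

    -- Column `τ` is reached from a column `σ` two apart. The displacement `2 + 2 * (τ - σ) * odd m`
    -- is twice an odd number, so both places lie on a line of odd step. Equating it with
    -- `(τ - σ) * odd M` gives `M = 2m` or `M = 2m + 1`, according to the sign of `τ - σ`.
    next-row-zero : ∀ e m → (∀ τ → g τ (even (e + pos τ * odd m)) ≡ not κ) →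
                    ∀ τ → g τ (even (e + + 1 + pos τ * odd m)) ≡ κ
    next-row-zero e m p 0F = trans (cong (g 0F) (eq e m)) (proj₁ (zero₂ _ (m + m) (p 2F)))
      where eq : ∀ e m → + 2 * (e + + 1 + + 0 * (+ 1 + + 2 * m)) ≡ + 2 * (e + + 2 * (+ 1 + + 2 * m)) +
                (+ 0 - + 2) * (+ 1 + + 2 * (m + m))
            eq = solve-∀
    next-row-zero e m p 1F = trans (cong (g 1F) (eq e m)) (zero₃₁ _ (m + m) (p 3F))
      where eq : ∀ e m → + 2 * (e + + 1 + + 1 * (+ 1 + + 2 * m)) ≡ + 2 * (e + + 3 * (+ 1 + + 2 * m)) +
                (+ 1 - + 3) * (+ 1 + + 2 * (m + m))
            eq = solve-∀
    next-row-zero e m p 2F = trans (cong (g 2F) (eq e m)) (zero₀₂ _ (m + m + + 1) (p 0F))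
      where eq : ∀ e m → + 2 * (e + + 1 + + 2 * (+ 1 + + 2 * m)) ≡ + 2 * (e + + 0 * (+ 1 + + 2 * m)) +
                (+ 2 - + 0) * (+ 1 + + 2 * (m + m + + 1))
            eq = solve-∀
    next-row-zero e m p 3F = trans (cong (g 3F) (eq e m)) (zero₁₃ _ (m + m + + 1) (p 1F))
      where eq : ∀ e m → + 2 * (e + + 1 + + 3 * (+ 1 + + 2 * m)) ≡ + 2 * (e + + 1 * (+ 1 + + 2 * m)) +
                (+ 3 - + 1) * (+ 1 + + 2 * (m + m + + 1))
            eq = solve-∀
    next-row-zero e m p 4F = trans (cong (g 4F) (eq e m)) (proj₂ (zero₂ _ (m + m + + 1) (p 2F)))
      where eq : ∀ e m → + 2 * (e + + 1 + + 4 * (+ 1 + + 2 * m)) ≡ + 2 * (e + + 2 * (+ 1 + + 2 * m)) +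
                (+ 4 - + 2) * (+ 1 + + 2 * (m + m + + 1))
            eq = solve-∀

  -- The second row is at `i + 2` rather than `i + 1` so that the same family `r` stands at even
  -- places in both; halved, those places move by one.
  record Split (i m : ℤ) : Set where
    field
      r      : Bool
      base   : ℤ
      evens  : ∀ τ → form r τ i (odd m) ≡ even (base + pos τ * odd m)
      odds   : ∀ τ → Σ[ n ∈ ℤ ] form (not r) τ i (odd m) ≡ odd n
      evens⁺ : ∀ τ → form r τ (i + + 2) (odd m) ≡ even (base + + 1 + pos τ * odd m)
      odds⁺  : ∀ τ → Σ[ n ∈ ℤ ] form (not r) τ (i + + 2) (odd m) ≡ odd n

  split : ∀ i m → Split i m
  split i m with parity i
  ... | inj₁ (a , refl) = record
    { r = false ; base = a
    ; evens  = λ τ → eq₁ a (pos τ) m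
    ; odds   = λ τ → a + pos τ + m + + 2 * pos τ * m , eq₂ a (pos τ) m
    ; evens⁺ = λ τ → eq₃ a (pos τ) m
    ; odds⁺  = λ τ → a + + 1 + pos τ + m + + 2 * pos τ * m , eq₄ a (pos τ) m }
    where
    eq₁ : ∀ a t m → + 2 * a + (+ 2 * t + + 0) * (+ 1 + + 2 * m) ≡ + 2 * (a + t * (+ 1 + + 2 * m))
    eq₁ = solve-∀
    eq₂ : ∀ a t m → + 2 * a + (+ 2 * t + + 1) * (+ 1 + + 2 * m) ≡ + 1 + + 2 * (a + t + m + + 2 * t * m)
    eq₂ = solve-∀
    eq₃ : ∀ a t m → + 2 * a + + 2 + (+ 2 * t + + 0) * (+ 1 + + 2 * m) ≡ + 2 * (a + + 1 + t * (+ 1 + + 2 * m))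
    eq₃ = solve-∀
    eq₄ : ∀ a t m → + 2 * a + + 2 + (+ 2 * t + + 1) * (+ 1 + + 2 * m) ≡ + 1 + + 2 * (a + + 1 + t + m + + 2 * t * m)
    eq₄ = solve-∀
  ... | inj₂ (b , refl) = record
    { r = true ; base = b + m + + 1
    ; evens  = λ τ → eq₁ b (pos τ) m
    ; odds   = λ τ → b + pos τ + + 2 * pos τ * m , eq₂ b (pos τ) m
    ; evens⁺ = λ τ → eq₃ b (pos τ) m
    ; odds⁺  = λ τ → b + + 1 + pos τ + + 2 * pos τ * m , eq₄ b (pos τ) m }
    where
    eq₁ : ∀ b t m → + 1 + + 2 * b + (+ 2 * t + + 1) * (+ 1 + + 2 * m) ≡ + 2 * (b + m + + 1 + t * (+ 1 + + 2 * m))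
    eq₁ = solve-∀
    eq₂ : ∀ b t m → + 1 + + 2 * b + (+ 2 * t + + 0) * (+ 1 + + 2 * m) ≡ + 1 + + 2 * (b + t + + 2 * t * m)
    eq₂ = solve-∀
    eq₃ : ∀ b t m → + 1 + + 2 * b + + 2 + (+ 2 * t + + 1) * (+ 1 + + 2 * m) ≡ + 2 * (b + m + + 1 + + 1 + t *
        (+ 1 + + 2 * m))
    eq₃ = solve-∀
    eq₄ : ∀ b t m → + 1 + + 2 * b + + 2 + (+ 2 * t + + 0) * (+ 1 + + 2 * m) ≡ + 1 + + 2 * (b + + 1 + t + + 2 * t * m)
    eq₄ = solve-∀

  Const-value : ∀ {f} → Const f → ∀ r τ r′ τ′ → f r τ ≡ f r′ τ′
  Const-value c r τ r′ τ′ = trans (c r τ) (sym (c r′ τ′))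

  two-constants : ∀ {b f} r c d → c ≢ d → (∀ τ → f r τ ≡ c) → (∀ τ → f (not r) τ ≡ d) → ¬ (Const f ⊎ Mixed b f)
  two-constants r c d c≢d p q (inj₁ k) = c≢d (trans (sym (p 0F)) (trans (Const-value k r 0F (not r) 0F) (q 0F)))
  two-constants false c d c≢d p q (inj₂ (false , _ , a)) = Alt-nonconst d q a
  two-constants true  c d c≢d p q (inj₂ (false , _ , a)) = Alt-nonconst c p a
  two-constants false c d c≢d p q (inj₂ (true  , _ , a)) = Alt-nonconst c p a
  two-constants true  c d c≢d p q (inj₂ (true  , _ , a)) = Alt-nonconst d q a

  κ≢not : ∀ {κ} → κ ≢ not κ
  κ≢not {false} ()
  κ≢not {true} ()

  module _ {κ : Bool} {H : Columns} {B : ℤ → Bool} (alt : ∀ r → AltRows κ (H r)) (any : Ruled H B)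
           (ones : ∀ r τ m → H r τ (odd m) ≡ not κ) where

    -- One family stands at odd places, so a constant row has the value `not κ`. By `next-row-zero`
    -- the row at `i + 2` then has one family constantly `κ` and the other constantly `not κ`, which
    -- is neither `Const` nor `Mixed`.
    odd-row-nonconst : ∀ i m → ¬ Const (rowOf H i (odd m))
    odd-row-nonconst i m c = two-constants r κ (not κ) κ≢not zeros (λ τ → at-odd (odds⁺ τ)) (any (i + + 2) (odd m))
      where
      open Split (split i m)
      at-odd : ∀ {r τ x} → Σ[ n ∈ ℤ ] x ≡ odd n → H r τ x ≡ not κ
      at-odd (n , refl) = ones _ _ n
      values : ∀ τ → H r τ (even (base + pos τ * odd m)) ≡ not κ
      values τ = trans (cong (H r τ) (sym (evens τ))) (trans (Const-value c r τ (not r) τ) (at-odd (odds τ)))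
      zeros : ∀ τ → rowOf H (i + + 2) (odd m) r τ ≡ κ
      zeros τ = trans (cong (H r τ) (evens⁺ τ)) (next-row-zero (alt r) (ones r) base m values τ)

    normalised-Sudoku : Sudoku H B
    normalised-Sudoku = record
      { ruled     = any
      ; odd-row   = λ i m → [ (λ c → ⊥-elim (odd-row-nonconst i m c)) , (λ p → p) ] (any i (odd m))
      ; const-row = λ l m r τ → trans (one′ r τ l m) (sym (one′ false 0F l m))
      }
      where
      one′ : ∀ r τ l m → rowOf H (odd l) (even m) r τ ≡ not κ
      one′ r τ l m = trans (cong (H r τ) (eq (coeff r τ) l m)) (ones r τ (l + coeff r τ * m))
        where eq : ∀ c l m → + 1 + + 2 * l + c * (+ 2 * m) ≡ + 1 + + 2 * (l + c * m)
              eq = solve-∀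

  -- Descent by halving and the absence of periods

  module Halving {F : Columns} {B : ℤ → Bool} (S : Sudoku F B) where
    open Sudoku S

    κ : Bool
    κ = F true 0F (+ 1)

    -- The rows with `j = 0` make all columns agree at a given odd place. Different odd places are
    -- linked by the row `(odd m , even (- m))`, in which slope 0 reads place `odd m` and slope 1
    -- reads place 1.
    at-odd : ∀ r τ m → F r τ (odd m) ≡ κ
    at-odd r τ m = trans (sym (e₀ r τ)) (trans (const-row m (+ 0) r τ) (trans (cong (F false 0F) (eq₀ (odd m))) base))
      where
      eq₀ : ∀ n → n + + 0 ≡ n
      eq₀ = solve-∀
      e₀ : ∀ r τ → rowOf F (odd m) (even (+ 0)) r τ ≡ F r τ (odd m)
      e₀ r τ = cong (F r τ) (eq (coeff r τ) (odd m))
        where eq : ∀ c n → n + c * + 0 ≡ n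
              eq = solve-∀
      base : F false 0F (odd m) ≡ κ
      base = trans (cong (F false 0F) (eq₁ m))
             (trans (sym (const-row m (- m) true 0F)) (cong (F true 0F) (eq₂ m)))
        where eq₁ : ∀ m → + 1 + + 2 * m ≡ + 1 + + 2 * m + (+ 2 * + 0 + + 0) * (+ 2 * (- m))
              eq₁ = solve-∀
              eq₂ : ∀ m → + 1 + + 2 * m + (+ 2 * + 0 + + 1) * (+ 2 * (- m)) ≡ + 1
              eq₂ = solve-∀

    G : Columns
    G r τ n = F r τ (even n)

    G-any : Ruled G (λ j → B (even j))
    G-any i j = Rule-cong {f = rowOf F (even i) (even j)} {g = rowOf G i j} refl same (ruled (even i) (even j))
      where
      same : ∀ r τ → rowOf F (even i) (even j) r τ ≡ rowOf G i j r τ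
      same r τ = cong (F r τ) (eq (coeff r τ) i j)
        where eq : ∀ c i j → + 2 * i + c * (+ 2 * j) ≡ + 2 * (i + c * j)
              eq = solve-∀

    -- In the row used here family `not r` stands at odd places and is constantly `κ` by `at-odd`.
    -- It therefore cannot be the `Alt` part of `Mixed`; it is the constant part, which also
    -- identifies `B (odd m)` with `κ`.
    G-alt : ∀ r → AltRows κ (G r)
    G-alt r = altRows λ A m → go A m (odd-row (even A - ⟦ r ⟧ * odd m) m)
      where
      module _ (A m : ℤ) where
        -- Chosen so that slope `2 τ + r` reads exactly `even (A + pos τ * odd m)`.
        i = even A - ⟦ r ⟧ * odd m
        same : ∀ τ → rowOf F i (odd m) r τ ≡ G r τ (A + pos τ * odd m)
        same τ = cong (F r τ) (eq ⟦ r ⟧ (pos τ) A m)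
          where eq : ∀ s t A m → + 2 * A - s * (+ 1 + + 2 * m) + (+ 2 * t + s) * (+ 1 + + 2 * m) ≡ + 2 *
                    (A + t * (+ 1 + + 2 * m))
                eq = solve-∀
        other : ∀ τ → rowOf F i (odd m) (not r) τ ≡ κ
        other τ = trans (cong (F (not r) τ) (trans (cong (λ x → i + (+ 2 * pos τ + x) * odd m) (⟦not⟧ r))
            (eq ⟦ r ⟧ (pos τ) A m)))
                        (at-odd (not r) τ (A - ⟦ r ⟧ * odd m + m + pos τ * odd m))
          where eq : ∀ s t A m → + 2 * A - s * (+ 1 + + 2 * m) + (+ 2 * t + (+ 1 - s)) * (+ 1 + + 2 * m)
                       ≡ + 1 + + 2 * (A - s * (+ 1 + + 2 * m) + m + t * (+ 1 + + 2 * m))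
                eq = solve-∀
        go : Mixed (B (odd m)) (rowOf F i (odd m)) → Alt κ (λ τ → G r τ (A + pos τ * odd m))
        go (r′ , c , a) with dichotomy r′ r
        ... | inj₁ refl = contradiction a (Alt-nonconst κ other)
        ... | inj₂ refl = subst (λ b → Alt b (λ τ → G r τ (A + pos τ * odd m))) (trans (sym (c 0F)) (other 0F))
            (Alt-cong (λ τ → trans (cong (λ s → rowOf F i (odd m) s τ) (not² r)) (same τ)) a)
          where not² : ∀ r → not (not r) ≡ r
                not² false = refl
                not² true  = refl

    offset : ∀ r → Σ[ o ∈ Bool ] (∀ τ m → G r τ (odd m + ⟦ o ⟧) ≡ not κ)
    offset = normal-form G-alt G-any

    -- Translation by `(o₀ , o₁)` moves the place in column `r τ` by `o₀ + coeff r τ * o₁`, which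
    -- modulo 2 is `o₀` for even slopes and `o₀ + o₁` for odd ones. So one translation corrects the
    -- independent offsets of both families.
    o₀ o₁ : Bool
    o₀ = proj₁ (offset false)
    o₁ = o₀ xor proj₁ (offset true)

    shift : Bool → Fin 5 → ℤ
    shift r τ = ⟦ o₀ ⟧ + coeff r τ * ⟦ o₁ ⟧

    H : Columns
    H r τ n = G r τ (n + shift r τ)

    H-any : Ruled H (λ j → B (even (j + ⟦ o₁ ⟧)))
    H-any i j = Rule-cong {f = rowOf G (i + ⟦ o₀ ⟧) (j + ⟦ o₁ ⟧)} {g = rowOf H i j} refl same (G-any
        (i + ⟦ o₀ ⟧) (j + ⟦ o₁ ⟧))
      where
      same : ∀ r τ → rowOf G (i + ⟦ o₀ ⟧) (j + ⟦ o₁ ⟧) r τ ≡ rowOf H i j r τ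
      same r τ = cong (G r τ) (eq (coeff r τ) i j ⟦ o₀ ⟧ ⟦ o₁ ⟧)
        where eq : ∀ c i j a b → i + a + c * (j + b) ≡ i + c * j + (a + c * b)
              eq = solve-∀

    H-alt : ∀ r → AltRows κ (H r)
    H-alt r = altRows λ A m →
      row (G-alt r) (A + ⟦ o₀ ⟧ + ⟦ r ⟧ * ⟦ o₁ ⟧) (m + ⟦ o₁ ⟧) _ (λ τ → eq ⟦ r ⟧ (pos τ) A m ⟦ o₀ ⟧ ⟦ o₁ ⟧)
      where eq : ∀ s t A m a b → A + a + s * b + t * (+ 1 + + 2 * (m + b)) ≡ A + t * (+ 1 + + 2 * m) + (a +
                (+ 2 * t + s) * b)
            eq = solve-∀

    xor-shift : ∀ a b → Σ[ c ∈ ℤ ] ⟦ a ⟧ + ⟦ a xor b ⟧ ≡ ⟦ b ⟧ + even c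
    xor-shift false false = + 0 , refl
    xor-shift false true  = + 0 , refl
    xor-shift true  false = + 1 , refl
    xor-shift true  true  = + 0 , refl

    H-ones : ∀ r τ m → H r τ (odd m) ≡ not κ
    H-ones false τ m = trans (cong (G false τ) (eq (pos τ) m ⟦ o₀ ⟧ ⟦ o₁ ⟧)) (proj₂ (offset false) τ
        (m + pos τ * ⟦ o₁ ⟧))
      where eq : ∀ t m a b → + 1 + + 2 * m + (a + (+ 2 * t + + 0) * b) ≡ + 1 + + 2 * (m + t * b) + a
            eq = solve-∀
    H-ones true τ m = ones (xor-shift o₀ (proj₁ (offset true)))
      where eq₁ : ∀ t m a b → + 1 + + 2 * m + (a + (+ 2 * t + + 1) * b) ≡ + 1 + + 2 * (m + t * b) + (a + b)
            eq₁ = solve-∀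
            eq₂ : ∀ n b c → + 1 + + 2 * n + (b + + 2 * c) ≡ + 1 + + 2 * (n + c) + b
            eq₂ = solve-∀
            n : ℤ
            n = m + pos τ * ⟦ o₁ ⟧
            ones : Σ[ c ∈ ℤ ] ⟦ o₀ ⟧ + ⟦ o₁ ⟧ ≡ ⟦ proj₁ (offset true) ⟧ + even c → H true τ (odd m) ≡ not κ
            ones (c , e) = trans
              (cong (G true τ) (trans (eq₁ (pos τ) m ⟦ o₀ ⟧ ⟦ o₁ ⟧) (trans (cong (λ x → odd n + x) e)
                (eq₂ n ⟦ proj₁ (offset true) ⟧ c))))
              (proj₂ (offset true) τ (n + c))

    halved : Sudoku H (λ j → B (even (j + ⟦ o₁ ⟧)))
    halved = normalised-Sudoku H-alt H-any H-ones

    H-periodic : ∀ p → (∀ r τ n → F r τ (n + even p) ≡ F r τ n) → ∀ r τ n → H r τ (n + p) ≡ H r τ n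
    H-periodic p per r τ n = trans (cong (F r τ) (eq n p (shift r τ))) (per r τ _)
      where eq : ∀ n p s → + 2 * (n + p + s) ≡ + 2 * (n + s) + + 2 * p
            eq = solve-∀

    -- An odd period carries odd places to even ones, so `at-odd` would make every column constantly
    -- `κ`, and the rows with odd `j` could not be `Mixed`.
    no-odd-period : ∀ p → ¬ (∀ r τ n → F r τ (n + odd p) ≡ F r τ n)
    no-odd-period p per = Mixed⇒¬Const (odd-row (+ 0) (+ 0)) λ r τ → trans (value r τ _) (sym (value false 0F _))
      where
      value : ∀ r τ n → F r τ n ≡ κ
      value r τ n with parity n
      ... | inj₂ (m , refl) = at-odd r τ m
      ... | inj₁ (m , refl) = trans (sym (per r τ (even m))) (trans (cong (F r τ) (eq m p)) (at-odd r τ (m + p)))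
        where eq : ∀ m p → + 2 * m + (+ 1 + + 2 * p) ≡ + 1 + + 2 * (m + p)
              eq = solve-∀

  parityℕ : ∀ n → (Σ[ m ∈ ℕ ] n ≡ 2 ℕ.* m) ⊎ (Σ[ m ∈ ℕ ] n ≡ 1 ℕ.+ 2 ℕ.* m)
  parityℕ ℕ.zero = inj₁ (0 , refl)
  parityℕ (ℕ.suc n) with parityℕ n
  ... | inj₁ (m , refl) = inj₂ (m , refl)
  ... | inj₂ (m , refl) = inj₁ (ℕ.suc m , sym (ℕ.*-suc 2 m))

  aperiodic-Sudoku : ∀ {N} → Acc ℕ._<_ N → 0 ℕ.< N → ∀ {F B} → Sudoku F B → ¬ (∀ r τ n → F r τ (n + + N) ≡ F r τ n)
  aperiodic-Sudoku {N} (acc rs) 0<N {F} S per with parityℕ N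
  ... | inj₂ (m , refl) = Halving.no-odd-period S (+ m) λ r τ n →
          trans (cong (λ x → F r τ (n + x)) (sym (trans (pos-+ 1 (2 ℕ.* m)) (cong (λ x → + 1 + x)
              (pos-* 2 m))))) (per r τ n)
  ... | inj₁ (ℕ.zero , refl) = contradiction 0<N (ℕ.n≮n 0)
  ... | inj₁ (ℕ.suc m , refl) = aperiodic-Sudoku (rs (ℕ.m<m+n (ℕ.suc m) ℕ.z<s)) ℕ.z<s (Halving.halved S)
          (Halving.H-periodic S (+ ℕ.suc m) λ r τ n →
            trans (cong (λ x → F r τ (n + x)) (sym (pos-* 2 (ℕ.suc m)))) (per r τ n))

  -- The 2-adic valuation satisfies the rule

  even-injective : ∀ {m n} → even m ≡ even n → m ≡ n
  even-injective {m} {n} = *-cancelˡ-≡ (+ 2) m n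

  even≢odd : ∀ m n → even m ≢ odd n
  even≢odd m n e = contradiction (trans (sym (abs-* (+ 2) (m - n))) (cong ∣_∣ (trans (eq m n) (trans (cong
      (_- + 2 * n) e) (eq′ n))))) (two∤1 ∣ m - n ∣)
    where
    eq : ∀ m n → + 2 * (m - n) ≡ + 2 * m - + 2 * n
    eq = solve-∀
    eq′ : ∀ n → + 1 + + 2 * n - + 2 * n ≡ + 1
    eq′ = solve-∀
    two∤1 : ∀ k → 2 ℕ.* k ≢ 1
    two∤1 (ℕ.suc k) e with trans (sym (ℕ.*-suc 2 k)) e
    ... | ()

  half : ∀ s {k} → 2 ℕ.* s ℕ.≤ ℕ.suc k → s ℕ.≤ k
  half ℕ.zero    _       = z≤n
  half (ℕ.suc s) (s≤s p) = ℕ.≤-trans (ℕ.m≤n+m (ℕ.suc s) s) (ℕ.≤-trans (ℕ.≤-reflexive (cong (s ℕ.+_) (sym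
      (ℕ.+-identityʳ (ℕ.suc s))))) p)

  -- The parity of the 2-adic valuation of n, with the value z at n = 0; the
  -- first argument is fuel.
  val : ℕ → Bool → ℤ → Bool
  val ℕ.zero    z n = z
  val (ℕ.suc k) z n with parity n
  ... | inj₁ (m , _) = not (val k (not z) m)
  ... | inj₂ _       = false

  val-zero : ∀ k z → val k z (+ 0) ≡ z
  val-zero ℕ.zero    z = refl
  val-zero (ℕ.suc k) z = trans (cong not (val-zero k (not z))) (not-involutive z)

  -- Fuel at least `∣ n ∣` can run out only once the argument has reached 0, where `val-zero` makes
  -- the result independent of fuel.
  val-fuel : ∀ k l z n → ∣ n ∣ ℕ.≤ k → ∣ n ∣ ℕ.≤ l → val k z n ≡ val l z n
  val-fuel ℕ.zero l z n p q with ∣i∣≡0⇒i≡0 {n} (ℕ.n≤0⇒n≡0 p)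
  ... | refl = sym (val-zero l z)
  val-fuel (ℕ.suc k) ℕ.zero z n p q with ∣i∣≡0⇒i≡0 {n} (ℕ.n≤0⇒n≡0 q)
  ... | refl = val-zero (ℕ.suc k) z
  val-fuel (ℕ.suc k) (ℕ.suc l) z n p q with parity n
  ... | inj₁ (m , refl) = cong not (val-fuel k l (not z) m (bound p) (bound q))
    where bound : ∀ {k} → ∣ even m ∣ ℕ.≤ ℕ.suc k → ∣ m ∣ ℕ.≤ k
          bound p = half ∣ m ∣ (subst (ℕ._≤ _) (abs-* (+ 2) m) p)
  ... | inj₂ _ = refl

  abstract
    ν : Bool → ℤ → Bool
    ν z n = val (ℕ.suc ∣ n ∣) z n

    ν-odd : ∀ z m → ν z (odd m) ≡ false
    ν-odd z m with parity (odd m)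
    ... | inj₁ (n , e) = contradiction (sym e) (even≢odd n m)
    ... | inj₂ _       = refl

    -- The value at 0 is complemented together with the result, so the recursion holds at `m = 0` as
    -- well.
    ν-even : ∀ z m → ν z (even m) ≡ not (ν (not z) m)
    ν-even z m with parity (even m)
    ... | inj₂ (n , e) = contradiction e (even≢odd m n)
    ... | inj₁ (n , e) with even-injective {m} {n} e
    ... | refl = cong not (val-fuel ∣ even m ∣ (ℕ.suc ∣ m ∣) (not z) m
                            (subst (∣ m ∣ ℕ.≤_) (sym (abs-* (+ 2) m)) (ℕ.m≤n*m ∣ m ∣ 2)) (ℕ.n≤1+n _))

  ν-even-odd : ∀ z m → ν z (even (odd m)) ≡ true
  ν-even-odd z m = trans (ν-even z (odd m)) (cong not (ν-odd (not z) m))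

  ν-even-even : ∀ z m → ν z (even (even m)) ≡ ν z m
  ν-even-even z m = trans (ν-even z (even m)) (trans (cong not (ν-even (not z) m))
    (trans (not-involutive _) (cong (λ b → ν b m) (not-involutive z))))

  ν-at : ∀ {z x b} y → x ≡ y → ν z y ≡ b → ν z x ≡ b
  ν-at y refl p = p

  -- For the `τ` of one parity `A + τ j` is odd, so its double has valuation 1. For the others it is
  -- even, and its half changes parity whenever `τ` grows by 2; where the half is odd, the double
  -- has valuation 2, giving `false`.
  ν-alt : ∀ z A m → Alt false (λ τ → ν z (even (A + pos τ * odd m)))
  ν-alt z A m with parity A
  ... | inj₁ (C , refl) = inj₁
        ( ν-at (even (odd (C + m))) (eq₁ C m) (ν-even-odd z (C + m))
        , ν-at (even (odd (C + + 1 + + 3 * m))) (eq₃ C m) (ν-even-odd z (C + + 1 + + 3 * m))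
        , rest (parity C))
    where
    eq₁ : ∀ C m → + 2 * (+ 2 * C + + 1 * (+ 1 + + 2 * m)) ≡ + 2 * (+ 1 + + 2 * (C + m))
    eq₁ = solve-∀
    eq₃ : ∀ C m → + 2 * (+ 2 * C + + 3 * (+ 1 + + 2 * m)) ≡ + 2 * (+ 1 + + 2 * (C + + 1 + + 3 * m))
    eq₃ = solve-∀
    rest : (Σ[ n ∈ ℤ ] C ≡ even n) ⊎ (Σ[ n ∈ ℤ ] C ≡ odd n) →
           (ν z (even (even C + pos 0F * odd m)) ≡ false × ν z (even (even C + pos 4F * odd m)) ≡ false)
           ⊎ ν z (even (even C + pos 2F * odd m)) ≡ false
    rest (inj₁ (n , refl)) = inj₂ (ν-at (even (even (odd (n + m)))) (eq n m) (trans (ν-even-even z (odd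
        (n + m))) (ν-odd z (n + m))))
      where eq : ∀ n m → + 2 * (+ 2 * (+ 2 * n) + + 2 * (+ 1 + + 2 * m)) ≡ + 2 * (+ 2 * (+ 1 + + 2 * (n + m)))
            eq = solve-∀
    rest (inj₂ (n , refl)) = inj₁
      ( ν-at (even (even (odd n))) (eq n m) (trans (ν-even-even z (odd n)) (ν-odd z n))
      , ν-at (even (even (odd (n + odd m)))) (eq′ n m) (trans (ν-even-even z (odd (n + odd m))) (ν-odd z (n + odd m))))
      where eq : ∀ n m → + 2 * (+ 2 * (+ 1 + + 2 * n) + + 0 * (+ 1 + + 2 * m)) ≡ + 2 * (+ 2 * (+ 1 + + 2 * n))
            eq = solve-∀
            eq′ : ∀ n m → + 2 * (+ 2 * (+ 1 + + 2 * n) + + 4 * (+ 1 + + 2 * m)) ≡ + 2 * (+ 2 * (+ 1 + + 2 * (n +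
                (+ 1 + + 2 * m))))
            eq′ = solve-∀
  ... | inj₂ (b , refl) = inj₂
        ( ν-at (even (odd b)) (eq₀ b m) (ν-even-odd z b)
        , ν-at (even (odd (b + odd m))) (eq₂ b m) (ν-even-odd z (b + odd m))
        , ν-at (even (odd (b + even (odd m)))) (eq₄ b m) (ν-even-odd z (b + even (odd m)))
        , rest (parity (b + m + + 1)))
    where
    eq₀ : ∀ b m → + 2 * (+ 1 + + 2 * b + + 0 * (+ 1 + + 2 * m)) ≡ + 2 * (+ 1 + + 2 * b)
    eq₀ = solve-∀
    eq₂ : ∀ b m → + 2 * (+ 1 + + 2 * b + + 2 * (+ 1 + + 2 * m)) ≡ + 2 * (+ 1 + + 2 * (b + (+ 1 + + 2 * m)))
    eq₂ = solve-∀
    eq₄ : ∀ b m → + 2 * (+ 1 + + 2 * b + + 4 * (+ 1 + + 2 * m)) ≡ + 2 * (+ 1 + + 2 * (b + + 2 * (+ 1 + + 2 * m)))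
    eq₄ = solve-∀
    eq₁ : ∀ b m → + 2 * (+ 1 + + 2 * b + + 1 * (+ 1 + + 2 * m)) ≡ + 2 * (+ 2 * (b + m + + 1))
    eq₁ = solve-∀
    eq₃ : ∀ b m → + 2 * (+ 1 + + 2 * b + + 3 * (+ 1 + + 2 * m)) ≡ + 2 * (+ 2 * (b + m + + 1 + (+ 1 + + 2 * m)))
    eq₃ = solve-∀
    eq : ∀ n m → + 2 * n + (+ 1 + + 2 * m) ≡ + 1 + + 2 * (n + m)
    eq = solve-∀
    rest : (Σ[ n ∈ ℤ ] b + m + + 1 ≡ even n) ⊎ (Σ[ n ∈ ℤ ] b + m + + 1 ≡ odd n) →
           ν z (even (odd b + pos 1F * odd m)) ≡ false ⊎ ν z (even (odd b + pos 3F * odd m)) ≡ false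
    rest (inj₁ (n , e)) = inj₂ (ν-at _ (eq₃ b m) (trans (ν-even-even z (b + m + + 1 + odd m))
      (ν-at (odd (n + m)) (trans (cong (_+ odd m) e) (eq n m)) (ν-odd z (n + m)))))
    rest (inj₂ (n , e)) = inj₁ (ν-at _ (eq₁ b m) (trans (ν-even-even z (b + m + + 1)) (ν-at (odd n) e (ν-odd z n))))

  columns : Bool → Columns
  columns z _ _ = ν z

  ν-odd-row : ∀ z z′ i m → Mixed (ν z′ (odd m)) (rowOf (columns z) i (odd m))
  ν-odd-row z z′ i m = subst (λ b → Mixed b _) (sym (ν-odd z′ m)) (go (split i m))
    where
    go : Split i m → Mixed false (rowOf (columns z) i (odd m))
    go s with Split.r s | Split.evens s | Split.odds s
    ... | false | e | o = true ,
      (λ τ → ν-at _ (proj₂ (o τ)) (ν-odd z (proj₁ (o τ)))) , Alt-cong (λ τ → cong (ν z) (sym (e τ))) (ν-alt z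
          (Split.base s) m)
    ... | true  | e | o = false ,
      (λ τ → ν-at _ (proj₂ (o τ)) (ν-odd z (proj₁ (o τ)))) , Alt-cong (λ τ → cong (ν z) (sym (e τ))) (ν-alt z
          (Split.base s) m)

  ν-const-row : ∀ z l m → Const (rowOf (columns z) (odd l) (even m))
  ν-const-row z l m r τ = trans (value r τ) (sym (value false 0F))
    where
    value : ∀ r τ → ν z (form r τ (odd l) (even m)) ≡ false
    value r τ = ν-at _ (eq (coeff r τ) l m) (ν-odd z (l + coeff r τ * m))
      where eq : ∀ c l m → + 1 + + 2 * l + c * (+ 2 * m) ≡ + 1 + + 2 * (l + c * m)
            eq = solve-∀

  Alt-not : ∀ {κ z} → Alt κ z → Alt (not κ) (λ τ → not (z τ))
  Alt-not (inj₁ (a , b , inj₁ (c , d))) = inj₁ (cong not a , cong not b , inj₁ (cong not c , cong not d))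
  Alt-not (inj₁ (a , b , inj₂ c))       = inj₁ (cong not a , cong not b , inj₂ (cong not c))
  Alt-not (inj₂ (a , b , c , inj₁ d))   = inj₂ (cong not a , cong not b , cong not c , inj₁ (cong not d))
  Alt-not (inj₂ (a , b , c , inj₂ d))   = inj₂ (cong not a , cong not b , cong not c , inj₂ (cong not d))

  Rule-not : ∀ {b} {f : Row} → Const f ⊎ Mixed b f → Const (λ r τ → not (f r τ)) ⊎ Mixed (not b) (λ r τ → not (f r τ))
  Rule-not (inj₁ p) = inj₁ λ r τ → cong not (p r τ)
  Rule-not {f = f} (inj₂ (r , p , a)) = inj₂ (r , (λ τ → cong not (p τ)) , Alt-not {z = f (not r)} a)

  -- Induction on a bound for `∣ i ∣ + ∣ j ∣`. When both are even, halving complements every bit,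
  -- under which the rule is stable; the values chosen at 0 are complemented too, hence the
  -- quantification over `z` and `z′`. At the origin the ten columns agree for any choice.
  ν-ruled : ∀ k z z′ i j → ∣ i ∣ ℕ.+ ∣ j ∣ ℕ.≤ k →
            Const (rowOf (columns z) i j) ⊎ Mixed (ν z′ j) (rowOf (columns z) i j)
  ν-ruled ℕ.zero z z′ i j p with ∣i∣≡0⇒i≡0 {i} (ℕ.n≤0⇒n≡0 (ℕ.m+n≤o⇒m≤o ∣ i ∣ p)) | ∣i∣≡0⇒i≡0 {j} (ℕ.n≤0⇒n≡0
      (ℕ.m+n≤o⇒n≤o ∣ i ∣ p))
  ... | refl | refl = inj₁ λ r τ → cong (ν z) (eq (coeff r τ))
    where eq : ∀ c → + 0 + c * + 0 ≡ + 0
          eq = solve-∀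
  ν-ruled (ℕ.suc k) z z′ i j p = by-parity (parity j) (parity i) p
    where
    module _ (l m : ℤ) (p : ∣ even l ∣ ℕ.+ ∣ even m ∣ ℕ.≤ ℕ.suc k) where
      bound : ∣ l ∣ ℕ.+ ∣ m ∣ ℕ.≤ k
      bound = half _ (subst (ℕ._≤ ℕ.suc k) (trans (cong₂ ℕ._+_ (abs-* (+ 2) l) (abs-* (+ 2) m)) (sym
          (ℕ.*-distribˡ-+ 2 ∣ l ∣ ∣ m ∣))) p)
      same : ∀ r τ → not (rowOf (columns (not z)) l m r τ) ≡ rowOf (columns z) (even l) (even m) r τ
      same r τ = trans (sym (ν-even z (l + coeff r τ * m))) (cong (ν z) (eq (coeff r τ) l m))
        where eq : ∀ c l m → + 2 * (l + c * m) ≡ + 2 * l + c * (+ 2 * m)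
              eq = solve-∀
      both-even : Const (rowOf (columns z) (even l) (even m)) ⊎ Mixed (ν z′ (even m)) (rowOf (columns z)
          (even l) (even m))
      both-even = Rule-cong (sym (ν-even z′ m)) same (Rule-not {f = rowOf (columns (not z)) l m} (ν-ruled k
          (not z) (not z′) l m bound))
    by-parity : ∀ {i j} → (Σ[ m ∈ ℤ ] j ≡ even m) ⊎ (Σ[ m ∈ ℤ ] j ≡ odd m) →
                (Σ[ m ∈ ℤ ] i ≡ even m) ⊎ (Σ[ m ∈ ℤ ] i ≡ odd m) → ∣ i ∣ ℕ.+ ∣ j ∣ ℕ.≤ ℕ.suc k →
                Const (rowOf (columns z) i j) ⊎ Mixed (ν z′ j) (rowOf (columns z) i j)
    by-parity {i} (inj₂ (m , refl)) _ _ = inj₂ (ν-odd-row z z′ i m)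
    by-parity (inj₁ (m , refl)) (inj₂ (l , refl)) _ = inj₁ (ν-const-row z l m)
    by-parity (inj₁ (m , refl)) (inj₁ (l , refl)) p = both-even l m p

  valuation-Sudoku : Sudoku (columns false) (ν false)
  valuation-Sudoku = record
    { ruled     = λ i j → ν-ruled _ false false i j ℕ.≤-refl
    ; odd-row   = ν-odd-row false false
    ; const-row = ν-const-row false
    }

module FunctionalEquations where
  open import Algebra.Bundles using (AbelianGroup)
  open import Data.Integer as ℤ using (ℤ; +_)
  open import Data.Nat using (zero; suc)
  open import Data.Product.Function.NonDependent.Propositional using (_×-↔_)
  open import Data.Product.Properties using (≡-dec)
  open import Data.Vec using (Vec; []; _∷_; head; tail; map; zipWith; replicate; lookup; tabulate; _[_]≔_)
  open import Data.Vec.Properties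
    using (zipWith-assoc; zipWith-comm; zipWith-identityˡ; zipWith-identityʳ; zipWith-inverseˡ; lookup-zipWith;
           lookup∘tabulate; tabulate∘lookup; tabulate-cong; lookup∘update)
  open import Function using (_∘_; id; _↔_; mk⇔; mk↔ₛ′; Inverse)
  open import Function.Properties.Inverse using (↔-trans; ↔-sym)
  open import Level using (0ℓ)
  open import Relation.Binary using (DecidableEquality)
  import Algebra.Properties.AbelianGroup as AbelianGroupProperties
  import Algebra.Structures as S
  import Data.Integer.Properties as ℤ

  -- Finite abelian groups and their homomorphisms

  ∀-bool? : {P : Bool → Set} → (∀ b → Dec (P b)) → Dec (∀ b → P b)
  ∀-bool? P? = map′ (λ { (f , t) false → f ; (f , t) true → t }) (λ p → p false , p true) (P? false ×-dec P? true)

  abelianGroup : FinAbGroup → AbelianGroup 0ℓ 0ℓ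
  abelianGroup A = record { isAbelianGroup = FinAbGroup.isAbelianGroup A }

  isAbelianGroup : ∀ {A : Set} {_+_ : A → A → A} {0# : A} { -_ : A → A } →
    (∀ x y z → (x + y) + z ≡ x + (y + z)) → (∀ x → 0# + x ≡ x) → (∀ x → (- x) + x ≡ 0#) →
    (∀ x y → x + y ≡ y + x) → S.IsAbelianGroup _≡_ _+_ 0# -_
  isAbelianGroup {_+_ = _+_} { -_ = -_} assoc idˡ invˡ comm = record
    { isGroup = record
      { isMonoid = record
        { isSemigroup = record
          { isMagma = record { isEquivalence = isEquivalence ; ∙-cong = cong₂ _+_ } ; assoc = assoc }
        ; identity = idˡ , λ x → trans (comm x _) (idˡ x) }
      ; inverse = invˡ , λ x → trans (comm x _) (invˡ x)
      ; ⁻¹-cong = cong -_ }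
    ; comm = comm }

  ℤ/2ᶠ : FinAbGroup
  ℤ/2ᶠ = record
    { Carrier = Bool ; _+_ = _xor_ ; 0# = false ; -_ = λ b → b
    ; isAbelianGroup = isAbelianGroup xor-assoc xor-identityˡ xor-same xor-comm
    ; size = 2 ; enum = ↔-sym 2↔Bool }

  _×ᶠ_ : FinAbGroup → FinAbGroup → FinAbGroup
  A ×ᶠ B = record
    { Carrier = A.Carrier × B.Carrier
    ; _+_ = λ (a , b) (a′ , b′) → (a A.+ a′) , (b B.+ b′)
    ; 0# = A.0# , B.0#
    ; -_ = λ (a , b) → (A.- a) , (B.- b)
    ; isAbelianGroup = isAbelianGroup
        (λ _ _ _ → cong₂ _,_ (GA.assoc _ _ _) (GB.assoc _ _ _))
        (λ _ → cong₂ _,_ (GA.identityˡ _) (GB.identityˡ _))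
        (λ _ → cong₂ _,_ (GA.inverseˡ _) (GB.inverseˡ _))
        (λ _ _ → cong₂ _,_ (GA.comm _ _) (GB.comm _ _))
    ; size = A.size ℕ.* B.size
    ; enum = ↔-trans (A.enum ×-↔ B.enum) (↔-sym *↔×) }
    where
    module A = FinAbGroup A
    module B = FinAbGroup B
    module GA = AbelianGroup (abelianGroup A)
    module GB = AbelianGroup (abelianGroup B)

  Vec↔ : ∀ {A : Set} {s} → A ↔ Fin s → ∀ n → Vec A n ↔ Fin (s ℕ.^ n)
  Vec↔ e zero    = mk↔ₛ′ (λ _ → zero) (λ _ → []) (λ { zero → refl }) (λ { [] → refl })
  Vec↔ e (suc n) = ↔-trans (mk↔ₛ′ (λ v → head v , tail v) (λ (x , v) → x ∷ v) (λ _ → refl) (λ { (x ∷ v) → refl }))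
                   (↔-trans (e ×-↔ Vec↔ e n) (↔-sym *↔×))

  _^ᶠ_ : FinAbGroup → ℕ → FinAbGroup
  A ^ᶠ n = record
    { Carrier = Vec A.Carrier n
    ; _+_ = zipWith A._+_
    ; 0# = replicate n A.0#
    ; -_ = map A.-_
    ; isAbelianGroup = isAbelianGroup (zipWith-assoc G.assoc) (zipWith-identityˡ G.identityˡ)
        (zipWith-inverseˡ G.inverseˡ) (zipWith-comm G.comm)
    ; size = A.size ℕ.^ n
    ; enum = Vec↔ A.enum n }
    where
    module A = FinAbGroup A
    module G = AbelianGroup (abelianGroup A)

  infixl 6 _+₄_
  infix 4 _≟₄_

  -- (a , b) stands for a + 2b modulo 4.
  _+₄_ : Bool × Bool → Bool × Bool → Bool × Bool
  (a , b) +₄ (c , d) = (a xor c) , ((b xor d) xor (a ∧ c))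

  _≟₄_ : DecidableEquality (Bool × Bool)
  _≟₄_ = ≡-dec _≟ᵇ_ _≟ᵇ_

  ℤ/4ᶠ : FinAbGroup
  ℤ/4ᶠ = record
    { Carrier = Bool × Bool ; _+_ = _+₄_ ; 0# = false , false ; -_ = λ (a , b) → a , (a xor b)
    ; isAbelianGroup = isAbelianGroup
        (λ (a , b) (c , d) (e , f) → toWitness {a? = ∀-bool? λ a → ∀-bool? λ b → ∀-bool? λ c → ∀-bool? λ d
            → ∀-bool? λ e → ∀-bool? λ f →
           ((a , b) +₄ (c , d)) +₄ (e , f) ≟₄ (a , b) +₄ ((c , d) +₄ (e , f))} tt a b c d e f)
        (λ (a , b) → toWitness {a? = ∀-bool? λ a → ∀-bool? λ b → (false , false) +₄ (a , b) ≟₄ (a , b)} tt a b)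
        (λ (a , b) → toWitness {a? = ∀-bool? λ a → ∀-bool? λ b → (a , (a xor b)) +₄ (a , b) ≟₄ (false , false)} tt a b)
        (λ (a , b) (c , d) → toWitness {a? = ∀-bool? λ a → ∀-bool? λ b → ∀-bool? λ c → ∀-bool? λ d →
           (a , b) +₄ (c , d) ≟₄ (c , d) +₄ (a , b)} tt a b c d)
    ; size = 4 ; enum = ↔-trans (↔-sym 2↔Bool ×-↔ ↔-sym 2↔Bool) (↔-sym (*↔× {2} {2})) }

  -- Codes, which unification can infer, unlike the eta-expanded records they stand for.
  infixr 4 _⊗_

  data Group : Set where
    ℤ/2 ℤ/4 : Group
    _⊗_     : Group → Group → Group
    _^ᴳ_    : Group → ℕ → Group

  ⟦_⟧ᴳ : Group → FinAbGroup
  ⟦ ℤ/2 ⟧ᴳ    = ℤ/2ᶠ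
  ⟦ ℤ/4 ⟧ᴳ    = ℤ/4ᶠ
  ⟦ A ⊗ B ⟧ᴳ  = ⟦ A ⟧ᴳ ×ᶠ ⟦ B ⟧ᴳ
  ⟦ A ^ᴳ n ⟧ᴳ = ⟦ A ⟧ᴳ ^ᶠ n

  ∣_∣ᴳ : Group → Set
  ∣ A ∣ᴳ = FinAbGroup.Carrier ⟦ A ⟧ᴳ

  ∥_∥ : Group → ℕ
  ∥ A ∥ = FinAbGroup.size ⟦ A ⟧ᴳ

  module _ (A : Group) where
    open FinAbGroup ⟦ A ⟧ᴳ

    decEq : DecidableEquality Carrier
    decEq x y = map′ (λ e → trans (sym (Inverse.strictlyInverseʳ enum x)) (trans (cong (Inverse.from enum) e)
        (Inverse.strictlyInverseʳ enum y)))
                     (cong (Inverse.to enum)) (Inverse.to enum x ≟ᶠ Inverse.to enum y)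

    element : Fin size → Carrier
    element = Inverse.from enum

    index : Carrier → Fin size
    index = Inverse.to enum

    element-index : ∀ x → element (index x) ≡ x
    element-index = Inverse.strictlyInverseʳ enum

    element-injective : ∀ {i j} → element i ≡ element j → i ≡ j
    element-injective {i} {j} e = trans (sym (Inverse.strictlyInverseˡ enum i)) (trans (cong
        (Inverse.to enum) e) (Inverse.strictlyInverseˡ enum j))

  record Hom (A B : Group) : Set where
    field
      ⟨_⟩  : ∣ A ∣ᴳ → ∣ B ∣ᴳ
      homo : ∀ x y → ⟨_⟩ (FinAbGroup._+_ ⟦ A ⟧ᴳ x y) ≡ FinAbGroup._+_ ⟦ B ⟧ᴳ (⟨_⟩ x) (⟨_⟩ y)

  open Hom public

  module _ {A B : Group} where
    fstʰ : Hom (A ⊗ B) A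
    fstʰ = record { ⟨_⟩ = proj₁ ; homo = λ _ _ → refl }

    sndʰ : Hom (A ⊗ B) B
    sndʰ = record { ⟨_⟩ = proj₂ ; homo = λ _ _ → refl }

  module _ {A B C : Group} where
    infixr 9 _∘ʰ_
    _∘ʰ_ : Hom B C → Hom A B → Hom A C
    g ∘ʰ f = record { ⟨_⟩ = ⟨ g ⟩ ∘ ⟨ f ⟩ ; homo = λ x y → trans (cong ⟨ g ⟩ (homo f x y)) (homo g _ _) }

    ⟪_,_⟫ : Hom A B → Hom A C → Hom A (B ⊗ C)
    ⟪ f , g ⟫ = record { ⟨_⟩ = λ x → ⟨ f ⟩ x , ⟨ g ⟩ x ; homo = λ x y → cong₂ _,_ (homo f x y) (homo g x y) }

  module _ {A B : Group} where
    open AbelianGroup (abelianGroup ⟦ B ⟧ᴳ) using (assoc; comm)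
    open FinAbGroup ⟦ B ⟧ᴳ using (_+_)

    _⊞_ : Hom A B → Hom A B → Hom A B
    f ⊞ g = record
      { ⟨_⟩  = λ x → ⟨ f ⟩ x + ⟨ g ⟩ x
      ; homo = λ x y → trans (cong₂ _+_ (homo f x y) (homo g x y)) (interchange (⟨ f ⟩ x) (⟨ f ⟩ y) (⟨ g ⟩ x)
            (⟨ g ⟩ y)) }
      where
      interchange : ∀ a b c d → (a + b) + (c + d) ≡ (a + c) + (b + d)
      interchange a b c d = trans (assoc a b _) (trans (cong (λ u → a + u) (trans (sym (assoc b c d)) (trans
          (cong (_+ d) (comm b c)) (assoc c b d)))) (sym (assoc a c _)))

  lookupʰ : ∀ {A n} → Fin n → Hom (A ^ᴳ n) A
  lookupʰ {A} i = record { ⟨_⟩ = λ v → lookup v i ; homo = λ x y → lookup-zipWith (FinAbGroup._+_ ⟦ A ⟧ᴳ) i x y }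

  parityʰ : Hom ℤ/4 ℤ/2
  parityʰ = record { ⟨_⟩ = proj₁ ; homo = λ _ _ → refl }

  doubleʰ : Hom ℤ/2 ℤ/4
  doubleʰ = record { ⟨_⟩ = λ b → false , b ; homo = λ x y → cong (false ,_) (xor-comm-false x y) }
    where xor-comm-false : ∀ x y → x xor y ≡ (x xor y) xor false
          xor-comm-false x y = xor-comm false (x xor y)

  maskʰ : ∀ {n} → Vec Bool n → Hom (ℤ/2 ^ᴳ n) (ℤ/2 ^ᴳ n)
  maskʰ k = record { ⟨_⟩ = zipWith (λ s b → not s ∧ b) k ; homo = distrib k }
    where
    distrib : ∀ {n} (k x y : Vec Bool n) → zipWith (λ s b → not s ∧ b) k (zipWith _xor_ x y) ≡
              zipWith _xor_ (zipWith (λ s b → not s ∧ b) k x) (zipWith (λ s b → not s ∧ b) k y)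
    distrib []      []      []      = refl
    distrib (s ∷ k) (a ∷ x) (b ∷ y) = cong₂ _∷_ (∧-distribˡ-xor (not s) a b) (distrib k x y)

  total : ∀ {n} → Vec Bool n → Bool
  total []      = false
  total (b ∷ v) = b xor total v

  xor-interchange : ∀ a b c d → (a xor b) xor (c xor d) ≡ (a xor c) xor (b xor d)
  xor-interchange = toWitness {a? = ∀-bool? λ a → ∀-bool? λ b → ∀-bool? λ c → ∀-bool? λ d → _ ≟ᵇ _} tt

  totalʰ : ∀ {n} → Hom (ℤ/2 ^ᴳ n) ℤ/2
  totalʰ = record { ⟨_⟩ = total ; homo = additive }
    where
    additive : ∀ {n} (x y : Vec Bool n) → total (zipWith _xor_ x y) ≡ total x xor total y
    additive []      []      = refl
    additive (a ∷ x) (b ∷ y) = trans (cong ((a xor b) xor_) (additive x y)) (xor-interchange a b (total x) (total y))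

  module Difference (A : Group) where
    open FinAbGroup ⟦ A ⟧ᴳ
    open AbelianGroup (abelianGroup ⟦ A ⟧ᴳ) using (assoc; comm; identityˡ; identityʳ; inverseˡ; inverseʳ)
    open AbelianGroupProperties (abelianGroup ⟦ A ⟧ᴳ)

    _⊖_ : Carrier → Carrier → Carrier
    x ⊖ y = x + (- y)

    ⊖-cancel : ∀ x y → y + (x ⊖ y) ≡ x
    ⊖-cancel x y = trans (comm y _) (trans (assoc x _ y) (trans (cong (λ u → x + u) (inverseˡ y)) (identityʳ x)))

    ⊖-unique : ∀ {x y e} → x ≡ y + e → e ≡ x ⊖ y
    ⊖-unique {x} {y} {e} refl = sym (xyx⁻¹≈y y e)

    ⊖-self : ∀ x → x ⊖ x ≡ 0#
    ⊖-self = inverseʳ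

    ⊖≡0⇒≡ : ∀ {x y} → x ⊖ y ≡ 0# → x ≡ y
    ⊖≡0⇒≡ = x∙y⁻¹≈ε⇒x≈y _ _

    +-cancel : ∀ {x y} c → x + c ≡ y + c → x ≡ y
    +-cancel c e = ∙-cancelʳ c _ _ e

    ⊖-unique′ : ∀ {x y c} → y ≡ x + c → x ⊖ y ≡ - c
    ⊖-unique′ {x} {y} {c} refl = sym (⊖-unique (sym (trans (assoc x c (- c)) (trans (cong (λ u → x + u)
        (inverseʳ c)) (identityʳ x)))))

    ⊖-shift : ∀ {x y c} → x ⊖ y ≡ - c → y ≡ x + c
    ⊖-shift {x} {y} {c} e = sym (trans (cong (_+ c) (trans (sym (⊖-cancel x y)) (cong (λ u → y + u) e)))
                                  (trans (assoc y (- c) c) (trans (cong (λ u → y + u) (inverseˡ c)) (identityʳ y))))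

  module _ {A B : Group} (f : Hom A B) where
    open Difference

    homo-⊖ : ∀ x y → ⟨ f ⟩ (_⊖_ A x y) ≡ _⊖_ B (⟨ f ⟩ x) (⟨ f ⟩ y)
    homo-⊖ x y = ⊖-unique B (trans (cong ⟨ f ⟩ (sym (⊖-cancel A x y))) (homo f y _))

  -- Partition conditions on a single group-valued function

  module Equations (G : AbGroupOps) (T : Group) where
    open AbGroupOps G using () renaming (Carrier to ∣G∣; _+_ to _+ᴳ_; 0# to 0ᴳ)
    open Difference T

    Disjoint-cover : (J : ℕ) → (Fin J → ∣ T ∣ᴳ) → (Fin J → ∣ T ∣ᴳ → Set) → Set
    Disjoint-cover J a D =
      (∀ q → Σ[ j ∈ Fin J ] D j (q ⊖ a j)) ×
      (∀ j j′ → j ≢ j′ → ∀ q → ¬ (D j (q ⊖ a j) × D j′ (q ⊖ a j′)))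

    record Equation : Set₁ where
      field
        J : ℕ
        h : Fin J → ∣G∣
        D : Fin J → ∣ T ∣ᴳ → Set

    record Holds (e : Equation) (a : ∣G∣ → ∣ T ∣ᴳ) : Set where
      constructor holds
      open Equation e
      field covers : ∀ x → Disjoint-cover J (λ j → a (x +ᴳ h j)) D

    open Holds public

    record System : Set₁ where
      constructor system
      field
        {M} : ℕ
        eqn : Fin M → Equation

    open System public

    record Solves (s : System) (a : ∣G∣ → ∣ T ∣ᴳ) : Set where
      constructor solves
      field solved : ∀ i → Holds (eqn s i) a

    open Solves public

    infixr 5 _∪_
    _∪_ : System → System → System
    s ∪ t = system {M s ℕ.+ M t} λ i → [ eqn s , eqn t ] (splitAt (M s) i)

    ∪-left : ∀ s t {a} → Solves (s ∪ t) a → Solves s a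
    ∪-left s t p = solves λ i → subst (λ u → Holds ([ eqn s , eqn t ] u) _) (splitAt-↑ˡ (M s) i (M t)) (solved p
        (i ↑ˡ M t))

    ∪-right : ∀ s t {a} → Solves (s ∪ t) a → Solves t a
    ∪-right s t p = solves λ i → subst (λ u → Holds ([ eqn s , eqn t ] u) _) (splitAt-↑ʳ (M s) (M t) i)
        (solved p (M s ↑ʳ i))

    ∪-intro : ∀ s t {a} → Solves s a → Solves t a → Solves (s ∪ t) a
    ∪-intro s t {a} p q = solves λ i → go (splitAt (M s) i)
      where
      go : ∀ u → Holds ([ eqn s , eqn t ] u) a
      go (inj₁ i) = solved p i
      go (inj₂ i) = solved q i

    module _ {Q : Group} (h : ∣G∣) (f : Hom T Q) (c : ∣ Q ∣ᴳ) where
      private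
        module Q = FinAbGroup ⟦ Q ⟧ᴳ
        module D = Difference Q

      -- The translates by `a x` and `a (x + h)` are a fibre of `f` and the complement of a fibre.
      -- They form a partition precisely when the two fibres coincide.
      Piece : Fin 2 → ∣ T ∣ᴳ → Set
      Piece 0F d = ⟨ f ⟩ d ≡ Q.0#
      Piece 1F d = ⟨ f ⟩ d ≢ Q.- c

      shift : Fin 2 → ∣G∣
      shift 0F = 0ᴳ
      shift 1F = h

      twoPoint : Equation
      twoPoint = record { J = 2 ; h = shift ; D = Piece }

      twoPoint-sound : ∀ {a} → Holds twoPoint a → ∀ x → ⟨ f ⟩ (a (x +ᴳ h)) ≡ ⟨ f ⟩ (a (x +ᴳ 0ᴳ)) Q.+ c
      -- The point `a₀` lies in the first translate, so disjointness keeps it out of the second;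
      -- decidable equality removes the double negation.
      twoPoint-sound {a} p x = D.⊖-shift (trans (sym (homo-⊖ f a₀ a₁)) (decidable-stable (decEq Q _ _) λ ne →
          proj₂ (covers p x) 0F 1F (λ ()) a₀ (trans (homo-⊖ f a₀ a₀) (D.⊖-self _) , ne)))
        where
        a₀ = a (x +ᴳ 0ᴳ)
        a₁ = a (x +ᴳ h)

      twoPoint-complete : ∀ {a} → (∀ x → ⟨ f ⟩ (a (x +ᴳ h)) ≡ ⟨ f ⟩ (a (x +ᴳ 0ᴳ)) Q.+ c) → Holds twoPoint a
      twoPoint-complete {a} p = holds λ x → cover x , disjoint x
        where
        module _ (x : ∣G∣) where
          a₀ = a (x +ᴳ 0ᴳ)
          a₁ = a (x +ᴳ h)
          exclusive : ∀ q → ⟨ f ⟩ (q ⊖ a₀) ≡ Q.0# → ⟨ f ⟩ (q ⊖ a₁) ≡ Q.- c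
          exclusive q e = trans (homo-⊖ f q a₁) (D.⊖-unique′ (trans (p x) (cong (Q._+ c) (sym (D.⊖≡0⇒≡ (trans
              (sym (homo-⊖ f q a₀)) e))))))
          exhaustive : ∀ q → ⟨ f ⟩ (q ⊖ a₁) ≡ Q.- c → ⟨ f ⟩ (q ⊖ a₀) ≡ Q.0#
          exhaustive q e = trans (homo-⊖ f q a₀) (trans (cong (D._⊖ ⟨ f ⟩ a₀) same) (D.⊖-self _))
            where same : ⟨ f ⟩ q ≡ ⟨ f ⟩ a₀
                  same = D.+-cancel c (trans (sym (D.⊖-shift (trans (sym (homo-⊖ f q a₁)) e))) (p x))
          cover : ∀ q → Σ[ j ∈ Fin 2 ] Piece j (q ⊖ a (x +ᴳ shift j))
          cover q with decEq Q (⟨ f ⟩ (q ⊖ a₀)) Q.0#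
          ... | yes e = 0F , e
          ... | no ne = 1F , λ e → ne (exhaustive q e)
          disjoint : ∀ j j′ → j ≢ j′ → ∀ q → ¬ (Piece j (q ⊖ a (x +ᴳ shift j)) × Piece j′ (q ⊖ a (x +ᴳ shift j′)))
          disjoint 0F 0F ne q _ = ne refl
          disjoint 0F 1F _ q (e , ne) = ne (exclusive q e)
          disjoint 1F 0F _ q (ne , e) = ne (exclusive q e)
          disjoint 1F 1F ne q _ = ne refl

  module Pairing (G : AbGroupOps) (V R : Group) where
    open AbGroupOps G using () renaming (Carrier to ∣G∣; _+_ to _+ᴳ_)
    open Equations G (V ⊗ R)
    module DV = Difference V
    module DR = Difference R
    open Difference (V ⊗ R)

    Hᵥ Hᵣ : Fin 1 → FinAbGroup
    Hᵥ _ = ⟦ V ⟧ᴳ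
    Hᵣ _ = ⟦ R ⟧ᴳ

    pair : Prod G [ Hᵥ , Hᵣ ]ᴴ → ∣ V ⊗ R ∣ᴳ
    pair y = y (inj₁ 0F) , y (inj₂ 0F)

    unpair : ∣ V ⊗ R ∣ᴳ → Prod G [ Hᵥ , Hᵣ ]ᴴ
    unpair (v , r) (inj₁ _) = v
    unpair (v , r) (inj₂ _) = r

    module _ (D : ∣ V ⊗ R ∣ᴳ → Set) (a y : Prod G [ Hᵥ , Hᵣ ]ᴴ) where
      -- `pair (unpair q)` computes to `q`, whereas `unpair (pair y)` agrees with `y` only
      -- pointwise. Sets of products are therefore always preimages under `pair`, which depend only
      -- on the two values.
      member : D (pair y ⊖ pair a) → _∈_+ₛ_ G [ Hᵥ , Hᵣ ]ᴴ y a (D ∘ pair)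
      member d = unpair (pair y ⊖ pair a) , d ,
        λ { (inj₁ 0F) → sym (DV.⊖-cancel _ _) ; (inj₂ 0F) → sym (DR.⊖-cancel _ _) }

      unmember : _∈_+ₛ_ G [ Hᵥ , Hᵣ ]ᴴ y a (D ∘ pair) → D (pair y ⊖ pair a)
      unmember (e , d , p) = subst D (cong₂ _,_ (DV.⊖-unique (p (inj₁ 0F))) (DR.⊖-unique (p (inj₂ 0F)))) d

    module _ (s : System) where
      open Equation

      Property* : Property G [ Hᵥ , Hᵣ ]ᴴ
      Property* γ = ∀ i x → Partition G [ Hᵥ , Hᵣ ]ᴴ (J (eqn s i)) (λ j w → γ w (x +ᴳ h (eqn s i) j)) (λ j → D
          (eqn s i) j ∘ pair)

      solution : Tuple G [ Hᵥ , Hᵣ ]ᴴ → ∣G∣ → ∣ V ⊗ R ∣ᴳ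
      solution γ x = pair (λ w → γ w x)

      tuple : (∣G∣ → ∣ V ⊗ R ∣ᴳ) → Tuple G [ Hᵥ , Hᵣ ]ᴴ
      tuple a (inj₁ _) x = proj₁ (a x)
      tuple a (inj₂ _) x = proj₂ (a x)

      sound : ∀ {γ} → Property* γ → Solves s (solution γ)
      sound {γ} p = solves λ i → holds λ x →
        (λ q → let (j , m) = proj₁ (p i x) (unpair q) in j , unmember (D (eqn s i) j) _ (unpair q) m) ,
        (λ j j′ ne q (d , d′) → proj₂ (p i x) j j′ ne (unpair q)
          (member (D (eqn s i) j) _ (unpair q) d , member (D (eqn s i) j′) _ (unpair q) d′))

      complete : ∀ {a} → Solves s a → Property* (tuple a)
      complete {a} p i x =
        (λ y → let (j , d) = proj₁ (covers (solved p i) x) (pair y) in j , member (D (eqn s i) j) _ y d) ,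
        (λ j j′ ne y (m , m′) → proj₂ (covers (solved p i) x) j j′ ne (pair y)
          (unmember (D (eqn s i) j) _ y m , unmember (D (eqn s i) j′) _ y m′))

      -- Defined as the projection of `Property*`, so that weak expressibility holds by construction
      -- and all content lies in aperiodicity.
      Property₀ : Property G Hᵥ
      Property₀ α = Σ[ γ ∈ Tuple G [ Hᵥ , Hᵣ ]ᴴ ] ((∀ w x → γ (inj₁ w) x ≡ α w x) × Property* γ)

      weakly-expressible : WeaklyExpressible G Hᵥ Property₀
      weakly-expressible = 1 , Hᵣ , Property* ,
        (M s , (λ i → J (eqn s i)) , (λ i → h (eqn s i)) , (λ i j → D (eqn s i) j ∘ pair) , (λ _ → mk⇔ id id)) ,
        (λ _ → mk⇔ id id)

  -- Linear algebra over the field with two elements, and clocks modulo 4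

  infixl 6 _⊕_
  _⊕_ : ∀ {n} → Vec Bool n → Vec Bool n → Vec Bool n
  _⊕_ = zipWith _xor_

  0ᵛ : ∀ {n} → Vec Bool n
  0ᵛ = replicate _ false

  ⊕-assoc : ∀ {n} (u v w : Vec Bool n) → u ⊕ v ⊕ w ≡ u ⊕ (v ⊕ w)
  ⊕-assoc = zipWith-assoc xor-assoc

  ⊕-identityˡ : ∀ {n} (v : Vec Bool n) → 0ᵛ ⊕ v ≡ v
  ⊕-identityˡ = zipWith-identityˡ xor-identityˡ

  ⊕-identityʳ : ∀ {n} (v : Vec Bool n) → v ⊕ 0ᵛ ≡ v
  ⊕-identityʳ = zipWith-identityʳ xor-identityʳ

  ⊕-self : ∀ {n} (v : Vec Bool n) → v ⊕ v ≡ 0ᵛ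
  ⊕-self []      = refl
  ⊕-self (b ∷ v) = cong₂ _∷_ (xor-same b) (⊕-self v)

  ⊕-cancelˡ : ∀ {n} (u v : Vec Bool n) → u ⊕ (u ⊕ v) ≡ v
  ⊕-cancelˡ u v = trans (sym (⊕-assoc u u v)) (trans (cong (_⊕ v) (⊕-self u)) (⊕-identityˡ v))

  lookup-ext : ∀ {A : Set} {n} {u v : Vec A n} → (∀ i → lookup u i ≡ lookup v i) → u ≡ v
  lookup-ext {u = u} {v} e = trans (sym (tabulate∘lookup u)) (trans (tabulate-cong e) (tabulate∘lookup v))

  infix 7 _∙_
  _∙_ : ∀ {n} → Vec Bool n → Vec Bool n → Bool
  u ∙ v = total (zipWith _∧_ u v)

  ∙-distribʳ : ∀ {n} (u v w : Vec Bool n) → u ∙ (v ⊕ w) ≡ u ∙ v xor u ∙ w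
  ∙-distribʳ []      []      []      = refl
  ∙-distribʳ (a ∷ u) (b ∷ v) (c ∷ w) =
    trans (cong₂ _xor_ (∧-distribˡ-xor a b c) (∙-distribʳ u v w)) (xor-interchange (a ∧ b) (a ∧ c) (u ∙ v) (u ∙ w))

  ∙-distribˡ : ∀ {n} (u v w : Vec Bool n) → (u ⊕ v) ∙ w ≡ u ∙ w xor v ∙ w
  ∙-distribˡ []      []      []      = refl
  ∙-distribˡ (a ∷ u) (b ∷ v) (c ∷ w) =
    trans (cong₂ _xor_ (distrib a b c) (∙-distribˡ u v w)) (xor-interchange (a ∧ c) (b ∧ c) (u ∙ w) (v ∙ w))
    where distrib : ∀ a b c → (a xor b) ∧ c ≡ (a ∧ c) xor (b ∧ c)
          distrib = toWitness {a? = ∀-bool? λ a → ∀-bool? λ b → ∀-bool? λ c → _ ≟ᵇ _} tt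

  -- k ↦ (d ∙ k , erase d k) is a bijection whenever d ≢ 0: the coordinate of k at
  -- the first 1 of d is dropped.
  erase : ∀ {n} → Vec Bool (suc n) → Vec Bool (suc n) → Vec Bool n
  erase          (true  ∷ d) (k ∷ ks) = ks
  erase {zero}   (false ∷ d) (k ∷ ks) = []
  erase {suc n}  (false ∷ d) (k ∷ ks) = k ∷ erase d ks

  erase-surjective : ∀ {n} (d : Vec Bool (suc n)) → d ≢ 0ᵛ → ∀ s v → Σ[ k ∈ Vec Bool (suc n) ] (d ∙ k
      ≡ s × erase d k ≡ v)
  erase-surjective (true ∷ d) _ s v = (s xor d ∙ v) ∷ v ,
    trans (xor-assoc s (d ∙ v) (d ∙ v)) (trans (cong (s xor_) (xor-same (d ∙ v))) (xor-identityʳ s)) , refl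
  erase-surjective {zero}  (false ∷ []) ne s v = contradiction refl ne
  erase-surjective {suc n} (false ∷ d) ne s (b ∷ v) with erase-surjective d (λ e → ne (cong (false ∷_) e)) s v
  ... | k , p , q = b ∷ k , p , cong (b ∷_) q

  xor-cancelʳ : ∀ a b c → a xor c ≡ b xor c → a ≡ b
  xor-cancelʳ = toWitness {a? = ∀-bool? λ a → ∀-bool? λ b → ∀-bool? λ c → (a xor c ≟ᵇ b xor c) →-dec (a ≟ᵇ b)} tt

  erase-injective : ∀ {n} (d : Vec Bool (suc n)) → d ≢ 0ᵛ → ∀ {k k′} → d ∙ k ≡ d ∙ k′ → erase d k ≡ erase d k′ → k ≡ k′
  erase-injective (true ∷ d) _ {k ∷ ks} {k′ ∷ .ks} e refl = cong (_∷ ks) (xor-cancelʳ k k′ (d ∙ ks) e)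
  erase-injective {zero}  (false ∷ []) ne _ _ = contradiction refl ne
  erase-injective {suc n} (false ∷ d) ne {k ∷ ks} {k′ ∷ ks′} e p with cong head p | cong tail p
  ... | refl | q = cong (k ∷_) (erase-injective d (λ e → ne (cong (false ∷_) e)) e q)

  ∀-pair? : {P : Bool × Bool → Set} → (∀ b → Dec (P b)) → Dec (∀ b → P b)
  ∀-pair? P? = map′ (λ f (a , b) → f a b) (λ f a b → f (a , b)) (∀-bool? λ a → ∀-bool? λ b → P? (a , b))

  double : Bool → Bool × Bool
  double = ⟨ doubleʰ ⟩

  -- Adding the two tie equations cancels `f` and `f′` and leaves `2 (r′ - r)`, which is 2 modulo 4
  -- because `r′ - r` is odd. Hypotheses alternate with variables so that the exhaustive check
  -- discards cases early.
  tick : ∀ r r′ → proj₁ r′ ≡ proj₁ r xor true →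
         ∀ f f′ b b′ → r′ +₄ f′ +₄ double b′ ≡ r +₄ f +₄ double b →
         ∀ c c′ → r′ +₄ f +₄ double c′ ≡ r +₄ f′ +₄ double c → c′ xor c ≡ not (b′ xor b)
  tick = toWitness {a? = ∀-pair? λ r → ∀-pair? λ r′ → (proj₁ r′ ≟ᵇ proj₁ r xor true) →-dec
    (∀-pair? λ f → ∀-pair? λ f′ → ∀-bool? λ b → ∀-bool? λ b′ → (r′ +₄ f′ +₄ double b′ ≟₄ r +₄ f +₄ double b) →-dec
    (∀-bool? λ c → ∀-bool? λ c′ → (r′ +₄ f +₄ double c′ ≟₄ r +₄ f′ +₄ double c) →-dec (c′ xor c ≟ᵇ not (b′ xor b))))} tt

  hold : ∀ r r′ f f′ b b′ → r′ +₄ f′ +₄ double b′ ≡ r +₄ f +₄ double b →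
         ∀ c c′ → r′ +₄ f′ +₄ double c′ ≡ r +₄ f +₄ double c → c′ xor c ≡ b′ xor b
  hold = toWitness {a? = ∀-pair? λ r → ∀-pair? λ r′ →
    (∀-pair? λ f → ∀-pair? λ f′ → ∀-bool? λ b → ∀-bool? λ b′ → (r′ +₄ f′ +₄ double b′ ≟₄ r +₄ f +₄ double b) →-dec
    (∀-bool? λ c → ∀-bool? λ c′ → (r′ +₄ f′ +₄ double c′ ≟₄ r +₄ f +₄ double c) →-dec (c′ xor c ≟ᵇ b′ xor b)))} tt

  -- Bits on the plane, encoded as slopes

  module Wires (n : ℕ) (Ω : Vec Bool (suc n) → Set) (Ω? : ∀ v → Dec (Ω v))
               (dir : Fin (suc n) → ℤ × ℤ) (c₁ c₂ : Fin (suc n)) where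

    record Wiring (b : ℤ → ℤ → Vec Bool (suc n)) : Set where
      field
        allowed : ∀ i j → Ω (b i j)
        along   : ∀ w i j → lookup (b (i ℤ.+ proj₁ (dir w)) (j ℤ.+ proj₂ (dir w))) w ≡ lookup (b i j) w
        tick₁   : ∀ i j → lookup (b (i ℤ.+ + 1) (j ℤ.+ + 0)) c₁ ≡ not (lookup (b i j) c₁)
        hold₁   : ∀ i j → lookup (b (i ℤ.+ + 0) (j ℤ.+ + 1)) c₁ ≡ lookup (b i j) c₁
        tick₂   : ∀ i j → lookup (b (i ℤ.+ + 0) (j ℤ.+ + 1)) c₂ ≡ not (lookup (b i j) c₂)
        hold₂   : ∀ i j → lookup (b (i ℤ.+ + 1) (j ℤ.+ + 0)) c₂ ≡ lookup (b i j) c₂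

    -- `Φ` holds one filler for each vector of `V` that a clause may exclude. `U` has one coordinate
    -- less than `V`, so that `ℤ/2 ⊗ U` and `V` have equal size. In `G₁` the factor `V` carries the
    -- slopes and the last `ℤ/2` is the involution `flip`.
    V U Φ R T G₁ : Group
    V  = ℤ/2 ^ᴳ suc n
    U  = ℤ/2 ^ᴳ n
    Φ  = U ^ᴳ ∥ V ∥
    R  = (ℤ/4 ⊗ ℤ/4 ⊗ ℤ/4) ⊗ Φ
    T  = V ⊗ R
    G₁ = V ⊗ ℤ/2

    G : AbGroupOps
    G = ℤ²× ⟦ G₁ ⟧ᴳ

    open AbGroupOps G using () renaming (Carrier to ∣G∣; _+_ to _+ᴳ_; 0# to 0ᴳ)
    open Equations G T

    at : ℤ → ℤ → Vec Bool (suc n) → Bool → ∣G∣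
    at i j k t = i , j , k , t

    at-cong : ∀ {i i′ j j′ k k′ t t′} → i ≡ i′ → j ≡ j′ → k ≡ k′ → t ≡ t′ → at i j k t ≡ at i′ j′ k′ t′
    at-cong refl refl refl refl = refl

    +ᴳ-identity : ∀ x → x +ᴳ 0ᴳ ≡ x
    +ᴳ-identity (i , j , k , t) = at-cong (ℤ.+-identityʳ i) (ℤ.+-identityʳ j) (⊕-identityʳ k) (xor-identityʳ t)

    inner : ∀ i j t s {k k′ m} → k ⊕ m ≡ k′ → at i j k t +ᴳ at (+ 0) (+ 0) m s ≡ at i j k′ (t xor s)
    inner i j t s e = at-cong (ℤ.+-identityʳ i) (ℤ.+-identityʳ j) e refl

    outer : ∀ i j k t s {d e} → at i j k t +ᴳ at d e 0ᵛ s ≡ at (i ℤ.+ d) (j ℤ.+ e) k (t xor s)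
    outer i j k t s = at-cong refl refl (⊕-identityʳ k) refl

    outer₀ : ∀ i j k t {d e} → at i j k t +ᴳ at d e 0ᵛ false ≡ at (i ℤ.+ d) (j ℤ.+ e) k t
    outer₀ i j k t = at-cong refl refl (⊕-identityʳ k) (xor-identityʳ t)

    βʰ : Hom T V
    βʰ = fstʰ

    clocksʰ : Hom T (ℤ/4 ⊗ ℤ/4 ⊗ ℤ/4)
    clocksʰ = fstʰ ∘ʰ sndʰ

    rʰ f₁ʰ f₂ʰ : Hom T ℤ/4
    rʰ  = fstʰ ∘ʰ clocksʰ
    f₁ʰ = fstʰ ∘ʰ sndʰ ∘ʰ clocksʰ
    f₂ʰ = sndʰ ∘ʰ sndʰ ∘ʰ clocksʰ

    fillerʰ : Fin (∥ V ∥) → Hom T U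
    fillerʰ i = lookupʰ i ∘ʰ sndʰ ∘ʰ sndʰ

    unit : Fin (suc n) → Vec Bool (suc n)
    unit w = 0ᵛ [ w ]≔ true

    lookup-unit : ∀ w → lookup (unit w) w ≡ true
    lookup-unit w = lookup∘update w 0ᵛ true

    single : Equation → System
    single e = system {1} λ _ → e

    invariant : ∀ {Q} → ∣G∣ → Hom T Q → Equation
    invariant {Q} h f = twoPoint h f (FinAbGroup.0# ⟦ Q ⟧ᴳ)

    invariant-sound : ∀ {Q} {h} {f : Hom T Q} {a} → Holds (invariant h f) a → ∀ x {y} → x +ᴳ h ≡ y → ⟨ f ⟩ (a y)
        ≡ ⟨ f ⟩ (a x)
    invariant-sound {Q} {h} {f} {a} p x refl = trans (twoPoint-sound h f _ p x)
      (trans (AbelianGroup.identityʳ (abelianGroup ⟦ Q ⟧ᴳ) _) (cong (λ x → ⟨ f ⟩ (a x)) (+ᴳ-identity x)))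

    invariant-complete : ∀ {Q} {h} {f : Hom T Q} {a} → (∀ x → ⟨ f ⟩ (a (x +ᴳ h)) ≡ ⟨ f ⟩ (a x)) → Holds
        (invariant h f) a
    invariant-complete {Q} {h} {f} {a} p = twoPoint-complete h f _ λ x → trans (p x)
      (sym (trans (AbelianGroup.identityʳ (abelianGroup ⟦ Q ⟧ᴳ) _) (cong (λ x → ⟨ f ⟩ (a x)) (+ᴳ-identity x))))

    e₁ e₂ flip : ∣G∣
    e₁   = at (+ 1) (+ 0) 0ᵛ false
    e₂   = at (+ 0) (+ 1) 0ᵛ false
    flip = at (+ 0) (+ 0) 0ᵛ true

    -- The slope of β_w in its own direction of the elementary abelian factor of G₁
    -- is the value of wire w; β_w is constant in all other directions.
    maskEq : Vec Bool (suc n) → Equation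
    maskEq m = invariant (at (+ 0) (+ 0) m false) ⟪ maskʰ m ∘ʰ βʰ , clocksʰ ⟫

    dirEq : Fin (suc n) → Equation
    dirEq w = invariant (at (proj₁ (dir w)) (proj₂ (dir w)) 0ᵛ false) (lookupʰ w ∘ʰ βʰ)

    flipEq parityEq r₁Eq r₂Eq : Equation
    flipEq   = invariant flip βʰ
    parityEq = twoPoint flip (parityʰ ∘ʰ rʰ) true
    r₁Eq     = invariant e₁ rʰ
    r₂Eq     = invariant e₂ rʰ

    -- r and f are ±1-valued up to a constant under `flip`, with f also changing
    -- sign along u; the third equation makes wire c record whether they agree.
    tickEq holdEq tieEq : Fin (suc n) → Hom T ℤ/4 → ℤ × ℤ → Equation
    tickEq c f (d , e) = invariant (at d e 0ᵛ true) f
    holdEq c f (d , e) = invariant (at e d 0ᵛ false) f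
    tieEq  c f _       = invariant (at (+ 0) (+ 0) (unit c) true) ((rʰ ⊞ f) ⊞ (doubleʰ ∘ʰ lookupʰ c ∘ʰ βʰ))

    clockSystem : Fin (suc n) → Hom T ℤ/4 → ℤ × ℤ → System
    clockSystem c f u = single (tickEq c f u) ∪ single (holdEq c f u) ∪ single (tieEq c f u)

    clauseʰ : Fin (∥ V ∥) → Hom T (ℤ/2 ⊗ U)
    clauseʰ i = ⟪ totalʰ ∘ʰ βʰ , fillerʰ i ⟫

    -- With `ε` the excluded vector, the translate for `k` is the fibre of `clauseʰ i` over its
    -- value at `x + k` plus `(ε ∙ k , 0)`. The translates partition exactly when these points run
    -- bijectively through `ℤ/2 ⊗ U`. An allowed vector gets a trivial equation, so that clauses can
    -- be indexed by all of `V`.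
    clauseEq : ∀ i → Dec (Ω (element V i)) → Equation
    clauseEq i (yes _) = record { J = 1 ; h = λ _ → 0ᴳ ; D = λ _ _ → ⊤ }
    clauseEq i (no _)  = record
      { J = ∥ V ∥
      ; h = λ k → at (+ 0) (+ 0) (element V k) false
      ; D = λ k d → ⟨ clauseʰ i ⟩ d ≡ (element V i ∙ element V k , 0ᵛ) }

    masks dirs clauses base wires : System
    masks   = system λ i → maskEq (element V i)
    dirs    = system dirEq
    clauses = system λ i → clauseEq i (Ω? (element V i))
    base    = single flipEq ∪ single parityEq ∪ single r₁Eq ∪ single r₂Eq
    wires   = masks ∪ dirs ∪ clauses ∪ base ∪ clockSystem c₁ f₁ʰ (+ 1 , + 0) ∪ clockSystem c₂ f₂ʰ (+ 0 , + 1)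

    single-sound : ∀ {e a} → Solves (single e) a → Holds e a
    single-sound p = solved p 0F

    single-complete : ∀ {e a} → Holds e a → Solves (single e) a
    single-complete p = solves λ _ → p

    slopes : (∣G∣ → Vec Bool (suc n)) → ℤ → ℤ → Vec Bool (suc n)
    slopes β i j = tabulate λ w → lookup (β (at i j (unit w) false)) w xor lookup (β (at i j 0ᵛ false)) w

    -- Reading a wiring off a solution

    module Sound {a : ∣G∣ → ∣ T ∣ᴳ} (p : Solves wires a) where
      private
        p₁ = ∪-right masks _ p
        p₂ = ∪-right dirs _ p₁
        p₃ = ∪-right clauses _ p₂
        p₄ = ∪-right base _ p₃
        p₅ = ∪-left base _ p₃
        p₆ = ∪-right (single flipEq) _ p₅
        p₇ = ∪-right (single parityEq) _ p₆

      β : ∣G∣ → Vec Bool (suc n)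
      β x = proj₁ (a x)

      b : ℤ → ℤ → Vec Bool (suc n)
      b = slopes β

      slope : Fin (suc n) → ℤ → ℤ → Bool
      slope w i j = lookup (β (at i j (unit w) false)) w xor lookup (β (at i j 0ᵛ false)) w

      b-slope : ∀ w i j → lookup (b i j) w ≡ slope w i j
      b-slope w i j = lookup∘tabulate (λ w → slope w i j) w

      mask-sound : ∀ m → Holds (maskEq m) a
      mask-sound m = subst (λ m → Holds (maskEq m) a) (element-index V m) (solved (∪-left masks _ p) (index V m))

      β-shift : ∀ w m x {y} → x +ᴳ at (+ 0) (+ 0) m false ≡ y → lookup m w ≡ false → lookup (β y) w ≡ lookup (β x) w
      β-shift w m x {y} e z = trans (sym (unmask (β y))) (trans (cong (λ v → lookup v w) (cong proj₁
          (invariant-sound (mask-sound m) x e))) (unmask (β x)))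
        where
        unmask : ∀ v → lookup (zipWith (λ s b → not s ∧ b) m v) w ≡ lookup v w
        unmask v = trans (lookup-zipWith (λ s b → not s ∧ b) w m v) (cong (λ s → not s ∧ lookup v w) z)

      clocks-shift : ∀ m x {y} → x +ᴳ at (+ 0) (+ 0) m false ≡ y → ⟨ clocksʰ ⟩ (a y) ≡ ⟨ clocksʰ ⟩ (a x)
      clocks-shift m x e = cong proj₂ (invariant-sound (mask-sound m) x e)

      -- By the mask equations, coordinate `w` of `β` depends on `k` only through its coordinate
      -- `w`; a function of one bit is affine.
      β-affine : ∀ i j k → β (at i j k false) ≡ β (at i j 0ᵛ false) ⊕ zipWith _∧_ (b i j) k
      β-affine i j k = lookup-ext λ w → trans (pointwise w (lookup k w) refl)
        (sym (trans (lookup-zipWith _xor_ w (β (at i j 0ᵛ false)) (zipWith _∧_ (b i j) k)) (cong (lookup (β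
            (at i j 0ᵛ false)) w xor_)
          (trans (lookup-zipWith _∧_ w (b i j) k) (cong (_∧ lookup k w) (b-slope w i j))))))
        where
        lemma : ∀ x y → y ≡ x xor (y xor x) ∧ true
        lemma = toWitness {a? = ∀-bool? λ x → ∀-bool? λ y → _ ≟ᵇ _} tt
        lemma₀ : ∀ x y → x ≡ x xor (y xor x) ∧ false
        lemma₀ = toWitness {a? = ∀-bool? λ x → ∀-bool? λ y → _ ≟ᵇ _} tt
        pointwise : ∀ w s → lookup k w ≡ s → lookup (β (at i j k false)) w ≡ lookup (β
            (at i j 0ᵛ false)) w xor slope w i j ∧ lookup k w
        pointwise w false e rewrite e = trans (β-shift w k (at i j 0ᵛ false) (inner i j false false (⊕-identityˡ k)) e)
          (lemma₀ (lookup (β (at i j 0ᵛ false)) w) (lookup (β (at i j (unit w) false)) w))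
        -- `k` is compared with `unit w`, from which it differs by a vector vanishing at `w`.
        pointwise w true  e rewrite e = trans
          (β-shift w (unit w ⊕ k) (at i j (unit w) false) (inner i j false false (⊕-cancelˡ (unit w) k))
            (trans (lookup-zipWith _xor_ w (unit w) k) (cong₂ _xor_ (lookup-unit w) e)))
          (lemma (lookup (β (at i j 0ᵛ false)) w) (lookup (β (at i j (unit w) false)) w))

      along : ∀ w i j → lookup (b (i ℤ.+ proj₁ (dir w)) (j ℤ.+ proj₂ (dir w))) w ≡ lookup (b i j) w
      along w i j = trans (b-slope w _ _) (trans (cong₂ _xor_ (moved (unit w)) (moved 0ᵛ)) (sym (b-slope w i j)))
        where
        moved : ∀ k → lookup (β (at (i ℤ.+ proj₁ (dir w)) (j ℤ.+ proj₂ (dir w)) k false)) w ≡ lookup (β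
            (at i j k false)) w
        moved k = invariant-sound (solved (∪-left dirs _ p₁) w) (at i j k false) (outer i j k false false)

      -- If `b i j` were `ε`, the slope of `total` would cancel against `ε ∙ k` and every piece
      -- would consist of points of total `t`. The point `q` has total `not t` and would be
      -- uncovered.
      not-excluded : ∀ ε i j → ¬ Ω ε → b i j ≢ ε
      not-excluded ε i j ¬Ωε b≡ε = go (Ω? (element V ι)) (covers (solved (∪-left clauses _ p₂) ι) (at i j 0ᵛ false))
        where
        ι = index V ε
        t = total (β (at i j 0ᵛ false))
        q : ∣ T ∣ᴳ
        q = (not t ∷ 0ᵛ) , FinAbGroup.0# ⟦ R ⟧ᴳ
        total-0ᵛ : ∀ n → total (0ᵛ {n}) ≡ false
        total-0ᵛ zero    = refl
        total-0ᵛ (suc n) = total-0ᵛ n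
        open Difference T
        absurd : ∀ s t → (not t xor false) xor (t xor s) ≢ s
        absurd false false ()
        absurd false true  ()
        absurd true  false ()
        absurd true  true  ()
        go : ∀ d → Disjoint-cover (Equation.J (clauseEq ι d)) (λ j′ → a (at i j 0ᵛ false +ᴳ Equation.h
            (clauseEq ι d) j′)) (Equation.D (clauseEq ι d)) → ⊥
        go (yes Ωε) _ = ¬Ωε (subst Ω (element-index V ε) Ωε)
        go (no _) (cover , _) with cover q
        ... | k , e = absurd (ε ∙ element V k) t (trans (cong₂ _xor_ (sym (cong (not t xor_)
            (total-0ᵛ n))) value) covered)
          where
          x = at i j 0ᵛ false +ᴳ at (+ 0) (+ 0) (element V k) false
          covered : total (not t ∷ 0ᵛ {n}) xor total (β x) ≡ ε ∙ element V k
          covered = trans (cong proj₁ (trans (sym (homo-⊖ (clauseʰ ι) q (a x))) e)) (cong (_∙ element V k)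
              (element-index V ε))
          value : t xor ε ∙ element V k ≡ total (β x)
          value = sym (trans (cong (λ x → total (β x)) (inner i j false false {k = 0ᵛ} {m = element V k}
              (⊕-identityˡ (element V k))))
                  (trans (cong total (β-affine i j (element V k))) (trans (homo (totalʰ {suc n}) (β
                      (at i j 0ᵛ false)) (zipWith _∧_ (b i j) (element V k))) (cong (λ v
                          → t xor v ∙ element V k) b≡ε))))

      allowed : ∀ i j → Ω (b i j)
      allowed i j = decidable-stable (Ω? (b i j)) λ ne → not-excluded (b i j) i j ne refl

      r-odd : ∀ x {y} → x +ᴳ flip ≡ y → proj₁ (⟨ rʰ ⟩ (a y)) ≡ proj₁ (⟨ rʰ ⟩ (a x)) xor true
      r-odd x refl = trans (twoPoint-sound flip (parityʰ ∘ʰ rʰ) true (single-sound (∪-left (single parityEq) _ p₆)) x)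
                           (cong (λ x → proj₁ (⟨ rʰ ⟩ (a x)) xor true) (+ᴳ-identity x))

      flip-at : ∀ i j k → at i j k false +ᴳ flip ≡ at i j k true
      flip-at i j k = inner i j false true (⊕-identityʳ k)

      module Clock (c : Fin (suc n)) (f : Hom T ℤ/4) (f-shift : ∀ m x {y} → x +ᴳ at (+ 0) (+ 0) m false ≡ y
          → ⟨ f ⟩ (a y) ≡ ⟨ f ⟩ (a x))
                   (d e : ℤ)
                   (q : Solves (clockSystem c f (d , e)) a)
                   (r-u : ∀ x → ⟨ rʰ ⟩ (a (x +ᴳ at d e 0ᵛ false)) ≡ ⟨ rʰ ⟩ (a x))
                   (r-u′ : ∀ x → ⟨ rʰ ⟩ (a (x +ᴳ at e d 0ᵛ false)) ≡ ⟨ rʰ ⟩ (a x)) where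
        private
          q₁ = ∪-right (single (tickEq c f (d , e))) _ q

        γ : ℤ → ℤ → Vec Bool (suc n) → Bool
        γ i j k = lookup (β (at i j k false)) c

        ρ φ : ℤ → ℤ → Bool → Bool × Bool
        ρ i j t = ⟨ rʰ ⟩ (a (at i j 0ᵛ t))
        φ i j t = ⟨ f ⟩ (a (at i j 0ᵛ t))

        tied : ∀ i j → ρ i j true +₄ φ i j true +₄ double (γ i j (unit c))
            ≡ ρ i j false +₄ φ i j false +₄ double (γ i j 0ᵛ)
        tied i j = trans (sym (cong₂ _+₄_ (cong₂ _+₄_ (cong proj₁ (clocks-shift (unit c) (at i j 0ᵛ true)
            (inner i j true false (⊕-identityˡ _))))
                                                      (f-shift (unit c) (at i j 0ᵛ true) (inner i j true false
                                                          (⊕-identityˡ _))))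
                                          (cong (λ v → double (lookup v c)) (invariant-sound (single-sound
                                              (∪-left (single flipEq) _ p₅)) _ (flip-at i j (unit c))))))
                   (invariant-sound (single-sound (∪-right (single (holdEq c f (d , e))) _ q₁))
                       (at i j 0ᵛ false) (inner i j false true (⊕-identityˡ _)))

        ρ-u : ∀ i j t → ρ (i ℤ.+ d) (j ℤ.+ e) t ≡ ρ i j t
        ρ-u i j t = trans (cong (λ x → ⟨ rʰ ⟩ (a x)) (sym (outer₀ i j 0ᵛ t))) (r-u (at i j 0ᵛ t))

        ρ-u′ : ∀ i j t → ρ (i ℤ.+ e) (j ℤ.+ d) t ≡ ρ i j t
        ρ-u′ i j t = trans (cong (λ x → ⟨ rʰ ⟩ (a x)) (sym (outer₀ i j 0ᵛ t))) (r-u′ (at i j 0ᵛ t))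

        φ-u : ∀ i j t → φ (i ℤ.+ d) (j ℤ.+ e) (t xor true) ≡ φ i j t
        φ-u i j t = invariant-sound (single-sound (∪-left (single (tickEq c f (d , e))) _ q)) (at i j 0ᵛ t)
            (outer i j 0ᵛ t true)

        φ-u′ : ∀ i j t → φ (i ℤ.+ e) (j ℤ.+ d) t ≡ φ i j t
        φ-u′ i j t = invariant-sound (single-sound (∪-left (single (holdEq c f (d , e))) _ q₁)) (at i j 0ᵛ t)
            (outer₀ i j 0ᵛ t)

        ticks : ∀ i j → lookup (b (i ℤ.+ d) (j ℤ.+ e)) c ≡ not (lookup (b i j) c)
        ticks i j = trans (b-slope c _ _) (trans
          -- Along `(d , e)` both values of `r` persist, while `tickEq` exchanges the two values of
          -- `f`; the tie equation at the new point is thus the swapped hypothesis of `tick`.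
          (tick (ρ i j false) (ρ i j true) (r-odd _ (flip-at i j 0ᵛ)) (φ i j false) (φ i j true) (γ i j 0ᵛ)
              (γ i j (unit c)) (tied i j) _ _
            (subst₂ _≡_ (cong (_+₄ double (γ (i ℤ.+ d) (j ℤ.+ e) (unit c))) (cong₂ _+₄_ (ρ-u i j true) (φ-u i j false)))
                        (cong (_+₄ double (γ (i ℤ.+ d) (j ℤ.+ e) 0ᵛ)) (cong₂ _+₄_ (ρ-u i j false) (φ-u i j true)))
                        (tied (i ℤ.+ d) (j ℤ.+ e))))
          (cong not (sym (b-slope c i j))))

        holds-still : ∀ i j → lookup (b (i ℤ.+ e) (j ℤ.+ d)) c ≡ lookup (b i j) c
        holds-still i j = trans (b-slope c _ _) (trans
          (hold (ρ i j false) (ρ i j true) (φ i j false) (φ i j true) (γ i j 0ᵛ) (γ i j (unit c)) (tied i j) _ _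
            (subst₂ _≡_ (cong (_+₄ double (γ (i ℤ.+ e) (j ℤ.+ d) (unit c))) (cong₂ _+₄_ (ρ-u′ i j true)
                (φ-u′ i j true)))
                        (cong (_+₄ double (γ (i ℤ.+ e) (j ℤ.+ d) 0ᵛ)) (cong₂ _+₄_ (ρ-u′ i j false) (φ-u′ i j false)))
                        (tied (i ℤ.+ e) (j ℤ.+ d))))
          (sym (b-slope c i j)))

      r-e₁ : ∀ x → ⟨ rʰ ⟩ (a (x +ᴳ e₁)) ≡ ⟨ rʰ ⟩ (a x)
      r-e₁ x = invariant-sound (single-sound (∪-left (single r₁Eq) _ p₇)) x refl

      r-e₂ : ∀ x → ⟨ rʰ ⟩ (a (x +ᴳ e₂)) ≡ ⟨ rʰ ⟩ (a x)
      r-e₂ x = invariant-sound (single-sound (∪-right (single r₁Eq) _ p₇)) x refl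

      module C₁ = Clock c₁ f₁ʰ (λ m x e → cong (λ u → proj₁ (proj₂ u)) (clocks-shift m x e)) (+ 1) (+ 0)
                        (∪-left (clockSystem c₁ f₁ʰ (+ 1 , + 0)) _ p₄) r-e₁ r-e₂
      module C₂ = Clock c₂ f₂ʰ (λ m x e → cong (λ u → proj₂ (proj₂ u)) (clocks-shift m x e)) (+ 0) (+ 1)
                        (∪-right (clockSystem c₁ f₁ʰ (+ 1 , + 0)) _ p₄) r-e₂ r-e₁

      wiring : Wiring b
      wiring = record
        { allowed = allowed ; along = along
        ; tick₁ = C₁.ticks ; hold₁ = C₁.holds-still
        ; tick₂ = C₂.ticks ; hold₂ = C₂.holds-still }

    -- Building a solution from a wiring

    module Complete {b : ℤ → ℤ → Vec Bool (suc n)} (w : Wiring b) where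
      open Wiring w

      -- All three values are 0 or 1 modulo 4. The sum of `r` and `f` is `2t` if the clock bit is
      -- true and 1 if it is false, so `flip` changes it by twice the bit, as the tie requires.
      clocks : ℤ → ℤ → Bool → ∣ ℤ/4 ⊗ ℤ/4 ⊗ ℤ/4 ∣ᴳ
      clocks i j t = (t , false) , (t xor not (lookup (b i j) c₁) , false) , (t xor not (lookup (b i j) c₂) , false)

      sol : ∣G∣ → ∣ T ∣ᴳ
      sol (i , j , k , t) = zipWith _∧_ (b i j) k , clocks i j t , tabulate (λ ι → erase (b i j ⊕ element V ι) k)

      masks-complete : Solves masks sol
      masks-complete = solves λ ι → invariant-complete λ (i , j , k , t) →
        trans (cong (λ x → ⟨ ⟪ maskʰ (element V ι) ∘ʰ βʰ , clocksʰ ⟫ ⟩ (sol x))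
            (inner i j t false {k} {m = element V ι} refl))
              (cong₂ _,_ (masked (b i j) k (element V ι)) (cong (clocks i j) (xor-identityʳ t)))
        where
        bit : ∀ m b k → not m ∧ (b ∧ (k xor m)) ≡ not m ∧ (b ∧ k)
        bit = toWitness {a? = ∀-bool? λ m → ∀-bool? λ b → ∀-bool? λ k → _ ≟ᵇ _} tt
        masked : ∀ {n} (b k m : Vec Bool n) → zipWith (λ s b → not s ∧ b) m (zipWith _∧_ b (k ⊕ m)) ≡ zipWith
            (λ s b → not s ∧ b) m (zipWith _∧_ b k)
        masked []      []      []      = refl
        masked (b ∷ v) (k ∷ u) (m ∷ w) = cong₂ _∷_ (bit m b k) (masked v u w)

      lookup-∧ : ∀ i j k w → lookup (zipWith _∧_ (b i j) k) w ≡ lookup (b i j) w ∧ lookup k w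
      lookup-∧ i j k w = lookup-zipWith _∧_ w (b i j) k

      dirs-complete : Solves dirs sol
      dirs-complete = solves λ w → invariant-complete λ (i , j , k , t) →
        trans (cong (λ x → lookup (proj₁ (sol x)) w) (outer₀ i j k t))
        (trans (lookup-∧ _ _ k w) (trans (cong (_∧ lookup k w) (along w i j)) (sym (lookup-∧ i j k w))))

      base-complete : Solves base sol
      base-complete =
        ∪-intro (single flipEq) _ (single-complete (invariant-complete λ (i , j , k , t) →
          cong (λ x → proj₁ (sol x)) (inner i j t true (⊕-identityʳ k))))
        (∪-intro (single parityEq) _ (single-complete (twoPoint-complete flip (parityʰ ∘ʰ rʰ) true λ (i , j , k , t) →
          cong (_xor true) (sym (xor-identityʳ t))))
        (∪-intro (single r₁Eq) (single r₂Eq)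
          (single-complete (invariant-complete λ (i , j , k , t) → cong (_, false) (xor-identityʳ t)))
          (single-complete (invariant-complete λ (i , j , k , t) → cong (_, false) (xor-identityʳ t)))))

      module Clock (c : Fin (suc n)) (f : Hom T ℤ/4) (d e : ℤ)
                   (f-sol : ∀ i j k t → ⟨ f ⟩ (sol (at i j k t)) ≡ (t xor not (lookup (b i j) c) , false))
                   (ticks : ∀ i j → lookup (b (i ℤ.+ d) (j ℤ.+ e)) c ≡ not (lookup (b i j) c))
                   (still : ∀ i j → lookup (b (i ℤ.+ e) (j ℤ.+ d)) c ≡ lookup (b i j) c) where

        tick-bit : ∀ t l → (t xor true) xor not (not l) ≡ t xor not l
        tick-bit = toWitness {a? = ∀-bool? λ t → ∀-bool? λ l → _ ≟ᵇ _} tt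

        tie-bit : ∀ t l s → (t xor true , false) +₄ ((t xor true) xor not l , false) +₄ double (l ∧ (s xor true)) ≡
                            (t , false) +₄ (t xor not l , false) +₄ double (l ∧ s)
        tie-bit = toWitness {a? = ∀-bool? λ t → ∀-bool? λ l → ∀-bool? λ s → _ ≟₄ _} tt

        clock-complete : Solves (clockSystem c f (d , e)) sol
        clock-complete =
          ∪-intro (single (tickEq c f (d , e))) _ (single-complete (invariant-complete λ (i , j , k , t) →
            trans (cong (λ x → ⟨ f ⟩ (sol x)) (outer i j k t true))
            (trans (f-sol _ _ k (t xor true)) (trans (cong (λ l → (t xor true) xor not l , false) (ticks i j))
            (trans (cong (_, false) (tick-bit t (lookup (b i j) c))) (sym (f-sol i j k t)))))))
          (∪-intro (single (holdEq c f (d , e))) (single (tieEq c f (d , e)))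
            (single-complete (invariant-complete λ (i , j , k , t) →
              trans (cong (λ x → ⟨ f ⟩ (sol x)) (outer₀ i j k t))
              (trans (f-sol _ _ k t) (trans (cong (λ l → t xor not l , false) (still i j)) (sym (f-sol i j k t))))))
            (single-complete (invariant-complete λ (i , j , k , t) →
              trans (cong (λ x → ⟨ (rʰ ⊞ f) ⊞ (doubleʰ ∘ʰ lookupʰ c ∘ʰ βʰ) ⟩ (sol x))
                  (inner i j t true {k} {m = unit c} refl))
              (trans (cong₂ (λ u v → (t xor true , false) +₄ u +₄ double v) (f-sol i j (k ⊕ unit c) (t xor true))
                (trans (lookup-∧ i j (k ⊕ unit c) c) (cong (lookup (b i j) c ∧_)
                  (trans (lookup-zipWith _xor_ c k (unit c)) (cong (lookup k c xor_) (lookup-unit c))))))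
              (trans (tie-bit t (lookup (b i j) c) (lookup k c))
              (sym (cong₂ (λ u v → (t , false) +₄ u +₄ double v) (f-sol i j k t) (lookup-∧ i j k c))))))))

      clauses-complete : Solves clauses sol
      clauses-complete = solves λ ι → clause ι (Ω? (element V ι))
        where
        open Difference T using (_⊖_)
        clause : ∀ ι d → Holds (clauseEq ι d) sol
        clause ι (yes _) = holds λ x → (λ q → 0F , tt) , λ { 0F 0F ne → contradiction refl ne }
        clause ι (no ¬Ωε) = holds λ (i , j , k₀ , t) → cover i j k₀ t , disjoint i j k₀ t
          where
          ε = element V ι
          module D₂ = Difference (ℤ/2 ⊗ U)
          module _ (i j : ℤ) (k₀ : Vec Bool (suc n)) (t : Bool) where
            d = b i j ⊕ ε
            d≢0 : d ≢ 0ᵛ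
            d≢0 e = ¬Ωε (subst Ω (trans (sym (⊕-identityʳ (b i j))) (trans (cong (b i j ⊕_) (sym e)) (⊕-cancelˡ
                (b i j) ε))) (allowed i j))
            shifted : Fin ∥ V ∥ → ∣G∣
            shifted k = at i j k₀ t +ᴳ at (+ 0) (+ 0) (element V k) false
            target : Vec Bool (suc n) → Vec Bool (suc n) → ∣ ℤ/2 ⊗ U ∣ᴳ
            target m e = (b i j ∙ m xor ε ∙ e) , erase d m
            value : ∀ k → FinAbGroup._+_ ⟦ ℤ/2 ⊗ U ⟧ᴳ (⟨ clauseʰ ι ⟩ (sol (shifted k))) (ε ∙ element V k , 0ᵛ)
                ≡ target (k₀ ⊕ element V k) (element V k)
            value k = trans (cong (λ x → FinAbGroup._+_ ⟦ ℤ/2 ⊗ U ⟧ᴳ (⟨ clauseʰ ι ⟩ (sol x))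
                (ε ∙ element V k , 0ᵛ)) (inner i j t false {k₀} {m = element V k} refl))
                      (cong₂ _,_ refl (trans (⊕-identityʳ _) (lookup∘tabulate (λ ι → erase (b i j ⊕ element V ι)
                          (k₀ ⊕ element V k)) ι)))
            -- The base point `k₀` contributes only the constant `ε ∙ k₀`, so bijectivity reduces to
            -- that of `m` going to `(d ∙ m , erase d m)`.
            collect : ∀ m → b i j ∙ m xor ε ∙ (k₀ ⊕ m) ≡ d ∙ m xor ε ∙ k₀
            collect m = trans (cong (b i j ∙ m xor_) (trans (∙-distribʳ ε k₀ m) (xor-comm (ε ∙ k₀) (ε ∙ m))))
                        (trans (sym (xor-assoc (b i j ∙ m) (ε ∙ m) (ε ∙ k₀))) (cong (_xor ε ∙ k₀) (sym
                            (∙-distribˡ (b i j) ε m))))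
            enter : ∀ q k → ⟨ clauseʰ ι ⟩ q ≡ target (k₀ ⊕ element V k) (element V k) → ⟨ clauseʰ ι ⟩ (q ⊖ sol
                (shifted k)) ≡ (ε ∙ element V k , 0ᵛ)
            enter q k e = trans (homo-⊖ (clauseʰ ι) q (sol (shifted k))) (sym (D₂.⊖-unique (trans e (sym (value k)))))
            leave : ∀ q k → ⟨ clauseʰ ι ⟩ (q ⊖ sol (shifted k)) ≡ (ε ∙ element V k , 0ᵛ) → ⟨ clauseʰ ι ⟩ q
                ≡ target (k₀ ⊕ element V k) (element V k)
            leave q k e = trans (sym (D₂.⊖-cancel (⟨ clauseʰ ι ⟩ q) (⟨ clauseʰ ι ⟩ (sol (shifted k))))) (trans
                (cong (FinAbGroup._+_ ⟦ ℤ/2 ⊗ U ⟧ᴳ (⟨ clauseʰ ι ⟩ (sol (shifted k)))) (trans (sym (homo-⊖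
                    (clauseʰ ι) q (sol (shifted k)))) e)) (value k))
            cover : ∀ q → Σ[ k ∈ Fin ∥ V ∥ ] ⟨ clauseʰ ι ⟩ (q ⊖ sol (shifted k)) ≡ (ε ∙ element V k , 0ᵛ)
            cover q with erase-surjective d d≢0 (proj₁ (⟨ clauseʰ ι ⟩ q) xor ε ∙ k₀) (proj₂ (⟨ clauseʰ ι ⟩ q))
            -- `k₀ ⊕ m` is the translation that takes `k₀` to the required point `m`.
            ... | m , p , r = index V (k₀ ⊕ m) , enter q _ (trans (cong₂ _,_ first (sym r))
                    (cong₂ target (sym (trans (cong (k₀ ⊕_) (element-index V (k₀ ⊕ m))) (⊕-cancelˡ k₀ m))) (sym
                        (element-index V (k₀ ⊕ m)))))
              where
              cancel : ∀ s e → (s xor e) xor e ≡ s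
              cancel s e = trans (xor-assoc s e e) (trans (cong (s xor_) (xor-same e)) (xor-identityʳ s))
              first : proj₁ (⟨ clauseʰ ι ⟩ q) ≡ b i j ∙ m xor ε ∙ (k₀ ⊕ m)
              first = sym (trans (collect m) (trans (cong (_xor ε ∙ k₀) p) (cancel _ (ε ∙ k₀))))
            disjoint : ∀ k k′ → k ≢ k′ → ∀ q → ¬ (⟨ clauseʰ ι ⟩ (q ⊖ sol (shifted k)) ≡ (ε ∙ element V k , 0ᵛ) ×
                                                  ⟨ clauseʰ ι ⟩ (q ⊖ sol (shifted k′)) ≡ (ε ∙ element V k′ , 0ᵛ))
            disjoint k k′ ne q (p , p′) = ne (element-injective V (trans (sym (⊕-cancelˡ k₀ (element V k)))
                (trans (cong (k₀ ⊕_) same) (⊕-cancelˡ k₀ (element V k′)))))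
              where
              m = k₀ ⊕ element V k
              m′ = k₀ ⊕ element V k′
              targets : target m (element V k) ≡ target m′ (element V k′)
              targets = trans (sym (leave q k p)) (leave q k′ p′)
              dot : ∀ k → b i j ∙ (k₀ ⊕ element V k) xor ε ∙ element V k ≡ d ∙ (k₀ ⊕ element V k) xor ε ∙ k₀
              dot k = trans (cong (λ e → b i j ∙ (k₀ ⊕ element V k) xor ε ∙ e) (sym (⊕-cancelˡ k₀
                  (element V k)))) (collect (k₀ ⊕ element V k))
              same : m ≡ m′
              same = erase-injective d d≢0 (xor-cancelʳ (d ∙ m) (d ∙ m′) (ε ∙ k₀) (trans (sym (dot k)) (trans
                  (cong proj₁ targets) (dot k′)))) (cong proj₂ targets)

      module C₁ = Clock c₁ f₁ʰ (+ 1) (+ 0) (λ _ _ _ _ → refl) tick₁ hold₁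
      module C₂ = Clock c₂ f₂ʰ (+ 0) (+ 1) (λ _ _ _ _ → refl) tick₂ hold₂

      wires-complete : Solves wires sol
      wires-complete = ∪-intro masks _ masks-complete (∪-intro dirs _ dirs-complete (∪-intro clauses _ clauses-complete
        (∪-intro base _ base-complete (∪-intro (clockSystem c₁ f₁ʰ
            (+ 1 , + 0)) _ C₁.clock-complete C₂.clock-complete))))

    -- Of the `n + 1` translations by `0, ..., n` in the first coordinate, two share one of the `n`
    -- coset representatives; their difference lies in the subgroup.
    finite-index-translation : ∀ (S : Subgroup G) → FiniteIndex G S →
      Σ[ N ∈ ℕ ] (0 ℕ.< N × Subgroup.mem S (at (+ N) (+ 0) 0ᵛ false))
    finite-index-translation S (n , r , cover) = search (pigeonhole (ℕ.n<1+n n) (λ k → proj₁ (cover (point k))))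
      where
      open Subgroup S
      module Δ = Difference G₁
      open FinAbGroup ⟦ G₁ ⟧ᴳ using () renaming (_+_ to _+₁_; -_ to -₁_)
      point : Fin (suc n) → ∣G∣
      point k = at (+ toℕ k) (+ 0) 0ᵛ false
      search : (Σ[ k ∈ Fin (suc n) ] Σ[ l ∈ Fin (suc n) ] (toℕ k ℕ.< toℕ l × proj₁ (cover (point k)) ≡ proj₁
          (cover (point l)))) →
               Σ[ N ∈ ℕ ] (0 ℕ.< N × mem (at (+ N) (+ 0) 0ᵛ false))
      search (k , l , k<l , same) with cover (point k) | cover (point l)
      search (k , l , k<l , refl) | c , s , s∈S , p | .c , s′ , s′∈S , p′ =
        toℕ l ℕ.∸ toℕ k , ℕ.m<n⇒0<n∸m k<l , subst mem difference (+-mem s′∈S (neg-mem s∈S))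
        where
        gap : ∀ c x y {a b} → a ≡ c ℤ.+ x → b ≡ c ℤ.+ y → y ℤ.+ ℤ.- x ≡ b ℤ.+ ℤ.- a
        gap c x y refl refl = eq c x y
          where eq : ∀ c x y → y ℤ.+ ℤ.- x ≡ c ℤ.+ y ℤ.+ ℤ.- (c ℤ.+ x)
                eq = solve-∀
        natural : + toℕ l ℤ.+ ℤ.- (+ toℕ k) ≡ + (toℕ l ℕ.∸ toℕ k)
        natural = trans (ℤ.m-n≡m⊖n (toℕ l) (toℕ k)) (ℤ.⊖-≥ (ℕ.<⇒≤ k<l))
        finite-part : ∀ g c x y → g ≡ c +₁ x → g ≡ c +₁ y → y +₁ (-₁ x) ≡ (0ᵛ , false)
        finite-part g c x y e e′ = trans (cong (_+₁ (-₁ x)) (trans (Δ.⊖-unique {g} {c} {y} e′) (sym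
            (Δ.⊖-unique {g} {c} {x} e)))) (Δ.⊖-self x)
        difference : s′ +ᴳ AbGroupOps.-_ G s ≡ at (+ (toℕ l ℕ.∸ toℕ k)) (+ 0) 0ᵛ false
        difference = cong₂ _,_
          (trans (gap (proj₁ (r c)) (proj₁ s) (proj₁ s′) (cong proj₁ p) (cong proj₁ p′)) natural)
          (cong₂ _,_ (gap (proj₁ (proj₂ (r c))) (proj₁ (proj₂ s)) (proj₁ (proj₂ s′)) (cong (λ x → proj₁
              (proj₂ x)) p) (cong (λ x → proj₁ (proj₂ x)) p′))
                     (finite-part (0ᵛ , false) (proj₂ (proj₂ (r c))) (proj₂ (proj₂ s)) (proj₂ (proj₂ s′)) (cong
                         (λ x → proj₂ (proj₂ x)) p) (cong (λ x → proj₂ (proj₂ x)) p′)))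

    module P = Pairing G V R

    Solvable : Property G P.Hᵥ
    Solvable = P.Property₀ wires

    solvable-weakly-expressible : WeaklyExpressible G P.Hᵥ Solvable
    solvable-weakly-expressible = P.weakly-expressible wires

    -- The slopes are differences of values of `β` over the same `(i , j)`, so a period of `β` in
    -- the first coordinate is a period of the slopes, and every finite-index subgroup contains such
    -- a translation.
    solvable-aperiodic : ∀ {b₀} → Wiring b₀ →
      (∀ {b} → Wiring b → ∀ N → 0 ℕ.< N → ¬ (∀ i j → b (i ℤ.+ + N) j ≡ b i j)) → Aperiodic G {H = P.Hᵥ} Solvable
    solvable-aperiodic W no-period =
      ((λ w → extended (inj₁ w)) , extended , (λ _ _ → refl) , P.complete wires (Complete.wires-complete W)) ,
      (λ α p → 0F , not-periodic α p)
      where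
      extended : Tuple G [ P.Hᵥ , P.Hᵣ ]ᴴ
      extended = P.tuple wires (Complete.sol W)
      not-periodic : ∀ α → Solvable α → ¬ Periodic G (α 0F)
      not-periodic α (γ , γ≡α , solved) (S , finite , invariance) = refute (finite-index-translation S finite)
        where
        module Solution = Sound (P.sound wires {γ} solved)
        refute : (Σ[ N ∈ ℕ ] (0 ℕ.< N × Subgroup.mem S (at (+ N) (+ 0) 0ᵛ false))) → ⊥
        refute (N , 0<N , N∈S) = no-period Solution.wiring N 0<N λ i j →
          tabulate-cong λ w → cong₂ (λ u v → lookup u w xor lookup v w) (translate i j (unit w)) (translate i j 0ᵛ)
          where
          translate : ∀ i j k → γ (inj₁ 0F) (at (i ℤ.+ + N) j k false) ≡ γ (inj₁ 0F) (at i j k false)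
          translate i j k = trans (γ≡α 0F _) (trans (cong (α 0F) (trans (cong (λ j → at (i ℤ.+ + N) j k false)
              (sym (ℤ.+-identityʳ j))) (sym (outer₀ i j k false))))
            (trans (invariance _ N∈S (at i j k false)) (sym (γ≡α 0F _))))

open ValuationSudoku
open FunctionalEquations
open import Data.Integer using (ℤ; +_; -[1+_]; _+_; _*_; _-_; -_)
open import Data.Integer.Properties using (+-identityʳ; +-comm; +-assoc)
open import Data.Nat.Induction using (<-wellFounded)
open import Data.Vec using (Vec; []; _∷_; lookup; tabulate)
open import Data.Vec.Properties using (lookup∘tabulate)

-- The rule as a wiring of thirteen bits

along-lines : ∀ {A : Set} (f : ℤ → ℤ → A) c → (∀ i j → f (i + - c) (j + + 1) ≡ f i j) →
              ∀ i j → f i j ≡ f (i + c * j) (+ 0)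
along-lines f c inv i (+ ℕ.zero) = cong (λ x → f x (+ 0)) (eq c i)
  where eq : ∀ c i → i ≡ i + c * + 0
        eq = solve-∀
along-lines f c inv i (+ ℕ.suc j) = trans
  (cong₂ f (eq c i) (+-comm (+ 1) (+ j)))
  (trans (inv (i + c) (+ j)) (trans (along-lines f c inv (i + c) (+ j)) (cong (λ x → f x (+ 0)) (eq′ c i (+ j)))))
  where eq : ∀ c i → i ≡ i + c + - c
        eq = solve-∀
        eq′ : ∀ c i j → i + c + c * j ≡ i + c * (+ 1 + j)
        eq′ = solve-∀
along-lines f c inv i -[1+ ℕ.zero ] = trans (sym (inv i -[1+ 0 ]))
  (cong (λ x → f x (+ 0)) (eq c i))
  where eq : ∀ c i → i + - c ≡ i + c * - (+ 1)
        eq = solve-∀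
along-lines f c inv i -[1+ ℕ.suc j ] = trans (sym (inv i -[1+ ℕ.suc j ]))
  (trans (along-lines f c inv (i + - c) -[1+ j ]) (cong (λ x → f x (+ 0)) (eq c i -[1+ j ])))
  where eq : ∀ c i j → i + - c + c * j ≡ i + c * (- (+ 1) + j)
        eq = solve-∀

data Wire : Set where
  column : Bool → Fin 5 → Wire
  line clock₁ clock₂ : Wire

wireList : Vec Wire 13
wireList = column false 0F ∷ column false 1F ∷ column false 2F ∷ column false 3F ∷ column false 4F
         ∷ column true 0F ∷ column true 1F ∷ column true 2F ∷ column true 3F ∷ column true 4F
         ∷ line ∷ clock₁ ∷ clock₂ ∷ []

wireIndex : Wire → Fin 13
wireIndex (column false 0F) = # 0
wireIndex (column false 1F) = # 1
wireIndex (column false 2F) = # 2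
wireIndex (column false 3F) = # 3
wireIndex (column false 4F) = # 4
wireIndex (column true 0F)  = # 5
wireIndex (column true 1F)  = # 6
wireIndex (column true 2F)  = # 7
wireIndex (column true 3F)  = # 8
wireIndex (column true 4F)  = # 9
wireIndex line              = # 10
wireIndex clock₁            = # 11
wireIndex clock₂            = # 12

wireList-index : ∀ w → lookup wireList (wireIndex w) ≡ w
wireList-index (column false 0F) = refl
wireList-index (column false 1F) = refl
wireList-index (column false 2F) = refl
wireList-index (column false 3F) = refl
wireList-index (column false 4F) = refl
wireList-index (column true 0F)  = refl
wireList-index (column true 1F)  = refl
wireList-index (column true 2F)  = refl
wireList-index (column true 3F)  = refl
wireList-index (column true 4F)  = refl
wireList-index line              = refl
wireList-index clock₁            = refl
wireList-index clock₂            = refl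

-- For a column this is the vector on which its linear form vanishes.
direction : Wire → ℤ × ℤ
direction (column r τ) = - coeff r τ , + 1
direction line         = + 1 , + 0
direction clock₁       = + 0 , + 1
direction clock₂       = + 1 , + 0

assemble : (Wire → Bool) → Vec Bool 13
assemble f = tabulate λ ι → f (lookup wireList ι)

_at-wire_ : Vec Bool 13 → Wire → Bool
v at-wire w = lookup v (wireIndex w)

assemble-at : ∀ f w → assemble f at-wire w ≡ f w
assemble-at f w = trans (lookup∘tabulate (λ ι → f (lookup wireList ι)) (wireIndex w)) (cong f (wireList-index w))

cells : (Wire → Bool) → Row
cells f r τ = f (column r τ)

-- The two clock wires are true on even i and even j respectively.
Admissible : (Wire → Bool) → Set
Admissible f = (f clock₂ ≡ true × f clock₁ ≡ true × Const (cells f))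
             ⊎ (f clock₂ ≡ true × f clock₁ ≡ true × Mixed (f line) (cells f))
             ⊎ (f clock₂ ≡ true × f clock₁ ≡ false × Const (cells f))
             ⊎ (f clock₂ ≡ false × Mixed (f line) (cells f))

Alt? : ∀ κ z → Dec (Alt κ z)
Alt? κ z = (z 1F ≟ᵇ not κ ×-dec z 3F ≟ᵇ not κ ×-dec ((z 0F ≟ᵇ κ ×-dec z 4F ≟ᵇ κ) ⊎-dec z 2F ≟ᵇ κ))
     ⊎-dec (z 0F ≟ᵇ not κ ×-dec z 2F ≟ᵇ not κ ×-dec z 4F ≟ᵇ not κ ×-dec (z 1F ≟ᵇ κ ⊎-dec z 3F ≟ᵇ κ))

Const? : ∀ f → Dec (Const f)
Const? f = ∀-bool? λ r → all? λ τ → f r τ ≟ᵇ f false 0F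

Mixed? : ∀ b f → Dec (Mixed b f)
Mixed? b f = map′ (λ { (inj₁ p) → false , p ; (inj₂ p) → true , p })
                 (λ { (false , p) → inj₁ p ; (true , p) → inj₂ p })
                 (class false ⊎-dec class true)
  where
  class : ∀ r → Dec ((∀ τ → f r τ ≡ b) × Alt b (f (not r)))
  class r = all? (λ τ → f r τ ≟ᵇ b) ×-dec Alt? b (f (not r))

Admissible? : ∀ f → Dec (Admissible f)
Admissible? f = (f clock₂ ≟ᵇ true ×-dec f clock₁ ≟ᵇ true ×-dec Const? (cells f))
          ⊎-dec (f clock₂ ≟ᵇ true ×-dec f clock₁ ≟ᵇ true ×-dec Mixed? (f line) (cells f))
          ⊎-dec (f clock₂ ≟ᵇ true ×-dec f clock₁ ≟ᵇ false ×-dec Const? (cells f))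
          ⊎-dec (f clock₂ ≟ᵇ false ×-dec Mixed? (f line) (cells f))

open Wires 12 (λ v → Admissible (v at-wire_)) (λ v → Admissible? (v at-wire_))
           (λ ι → direction (lookup wireList ι)) (wireIndex clock₁) (wireIndex clock₂)

Admissible-cong : ∀ {f g} → (∀ w → f w ≡ g w) → Admissible f → Admissible g
Admissible-cong e (inj₁ (p , q , c)) = inj₁ (trans (sym (e _)) p , trans (sym (e _)) q , Const-cong (λ _ _ → e _) c)
Admissible-cong e (inj₂ (inj₁ (p , q , m))) = inj₂ (inj₁ (trans (sym (e _)) p , trans (sym (e _)) q , Mixed-cong
    (e _) (λ _ _ → e _) m))
Admissible-cong e (inj₂ (inj₂ (inj₁ (p , q , c)))) = inj₂ (inj₂ (inj₁ (trans (sym (e _)) p , trans (sym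
    (e _)) q , Const-cong (λ _ _ → e _) c)))
Admissible-cong e (inj₂ (inj₂ (inj₂ (p , m)))) = inj₂ (inj₂ (inj₂ (trans (sym (e _)) p , Mixed-cong (e _) (λ _ _
    → e _) m)))

-- Two steps cancel, and induction over all integers is borrowed from `along-lines` with slope 0.
alternating : ∀ (g : ℤ → Bool) → (∀ n → g (n + + 1) ≡ not (g n)) → ∀ m → g (even m) ≡ g (+ 0)
alternating g step m = along-lines (λ _ m → g (even m)) (+ 0)
  (λ _ m → trans (cong g (eq m)) (trans (step (even m + + 1)) (trans (cong not (step (even m)))
      (not-involutive _)))) (+ 0) m
  where eq : ∀ m → + 2 * (m + + 1) ≡ + 2 * m + + 1 + + 1
        eq = solve-∀

module FromWiring {b : ℤ → ℤ → Vec Bool 13} (W : Wiring b) where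
  open Wiring W

  wire : Wire → ℤ → ℤ → Bool
  wire w i j = b i j at-wire w

  wire-along : ∀ w i j → wire w (i + proj₁ (direction w)) (j + proj₂ (direction w)) ≡ wire w i j
  wire-along w i j = subst (λ d → lookup (b (i + proj₁ (direction d)) (j + proj₂ (direction d))) (wireIndex w)
      ≡ wire w i j)
                           (wireList-index w) (along (wireIndex w) i j)

  clock₁-base : ∀ i j → wire clock₁ i j ≡ wire clock₁ i (+ 0)
  clock₁-base i j = trans (along-lines (wire clock₁) (+ 0) hold₁ i j) (cong (λ x → wire clock₁ x (+ 0)) (+-identityʳ i))

  transposed : ∀ (f : ℤ → ℤ → Bool) → (∀ i j → f (i + + 1) (j + + 0) ≡ f i j) → ∀ i j → f i j ≡ f (+ 0) j
  transposed f h i j = trans (along-lines (λ x y → f y x) (+ 0) (λ x y → h y x) j i) (cong (f (+ 0)) (+-identityʳ j))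

  -- A clock alternates but its phase is free. The origin is moved to where both clocks are true, so
  -- that they record the parities of the new coordinates.
  start₁ : Σ[ i₀ ∈ ℤ ] wire clock₁ i₀ (+ 0) ≡ true
  start₁ with wire clock₁ (+ 0) (+ 0) in e
  ... | true  = + 0 , e
  ... | false = + 1 , trans (tick₁ (+ 0) (+ 0)) (cong not e)

  start₂ : Σ[ j₀ ∈ ℤ ] wire clock₂ (+ 0) j₀ ≡ true
  start₂ with wire clock₂ (+ 0) (+ 0) in e
  ... | true  = + 0 , e
  ... | false = + 1 , trans (tick₂ (+ 0) (+ 0)) (cong not e)

  i₀ j₀ : ℤ
  i₀ = proj₁ start₁
  j₀ = proj₁ start₂

  wire′ : Wire → ℤ → ℤ → Bool
  wire′ w i j = wire w (i₀ + i) (j₀ + j)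

  F : Columns
  F r τ n = wire′ (column r τ) n (+ 0)

  B : ℤ → Bool
  B j = wire′ line (+ 0) j

  cells-F : ∀ i j r τ → wire′ (column r τ) i j ≡ rowOf F i j r τ
  cells-F i j r τ = along-lines (wire′ (column r τ)) (coeff r τ)
    (λ i j → trans (cong₂ (wire (column r τ)) (sym (+-assoc i₀ i _)) (sym (+-assoc j₀ j _))) (wire-along
        (column r τ) (i₀ + i) (j₀ + j))) i j

  line-B : ∀ i j → wire′ line i j ≡ B j
  line-B i j = trans (transposed (wire line) (wire-along line) (i₀ + i) (j₀ + j))
                     (sym (transposed (wire line) (wire-along line) (i₀ + + 0) (j₀ + j)))

  even-i : ∀ m j → wire′ clock₁ (even m) j ≡ true
  even-i m j = trans (clock₁-base (i₀ + even m) (j₀ + j)) (trans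
    (alternating (λ n → wire clock₁ (i₀ + n) (+ 0)) (λ n → trans (cong (λ x → wire clock₁ x (+ 0)) (sym
        (+-assoc i₀ n _))) (tick₁ (i₀ + n) (+ 0))) m)
    (trans (cong (λ x → wire clock₁ x (+ 0)) (+-identityʳ i₀)) (proj₂ start₁)))

  odd-i : ∀ m j → wire′ clock₁ (odd m) j ≡ false
  odd-i m j = trans (clock₁-base (i₀ + odd m) (j₀ + j)) (trans (cong (λ x → wire clock₁ x (+ 0)) (eq i₀ (even m)))
    (trans (tick₁ (i₀ + even m) (+ 0)) (cong not (trans (sym (clock₁-base (i₀ + even m) (j₀ + j))) (even-i m j)))))
    where eq : ∀ a b → a + (+ 1 + b) ≡ a + b + + 1
          eq = solve-∀

  clock₂-base : ∀ i j → wire clock₂ i j ≡ wire clock₂ (+ 0) j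
  clock₂-base = transposed (wire clock₂) hold₂

  even-j : ∀ i m → wire′ clock₂ i (even m) ≡ true
  even-j i m = trans (clock₂-base (i₀ + i) (j₀ + even m)) (trans
    (alternating (λ n → wire clock₂ (+ 0) (j₀ + n)) (λ n → trans (cong (wire clock₂ (+ 0)) (sym
        (+-assoc j₀ n _))) (tick₂ (+ 0) (j₀ + n))) m)
    (trans (cong (wire clock₂ (+ 0)) (+-identityʳ j₀)) (proj₂ start₂)))

  odd-j : ∀ i m → wire′ clock₂ i (odd m) ≡ false
  odd-j i m = trans (clock₂-base (i₀ + i) (j₀ + odd m)) (trans (cong (wire clock₂ (+ 0)) (eq j₀ (even m)))
    (trans (tick₂ (+ 0) (j₀ + even m)) (cong not (trans (sym (clock₂-base (i₀ + i) (j₀ + even m))) (even-j i m)))))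
    where eq : ∀ a b → a + (+ 1 + b) ≡ a + b + + 1
          eq = solve-∀

  toConst : ∀ i j → Const (cells (λ w → wire′ w i j)) → Const (rowOf F i j)
  toConst i j = Const-cong (cells-F i j)

  toMixed : ∀ i j → Mixed (wire′ line i j) (cells (λ w → wire′ w i j)) → Mixed (B j) (rowOf F i j)
  toMixed i j = Mixed-cong (line-B i j) (cells-F i j)

  sudoku : Sudoku F B
  sudoku = record { ruled = ruled ; odd-row = odd-row ; const-row = const-row }
    where
    ruled : Ruled F B
    ruled i j = go (allowed (i₀ + i) (j₀ + j))
      where
      go : Admissible (λ w → wire′ w i j) → Const (rowOf F i j) ⊎ Mixed (B j) (rowOf F i j)
      go (inj₁ (_ , _ , c))               = inj₁ (toConst i j c)
      go (inj₂ (inj₁ (_ , _ , p)))        = inj₂ (toMixed i j p)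
      go (inj₂ (inj₂ (inj₁ (_ , _ , c)))) = inj₁ (toConst i j c)
      go (inj₂ (inj₂ (inj₂ (_ , p))))     = inj₂ (toMixed i j p)

    odd-row : ∀ i m → Mixed (B (odd m)) (rowOf F i (odd m))
    odd-row i m = go (allowed (i₀ + i) (j₀ + odd m))
      where
      go : Admissible (λ w → wire′ w i (odd m)) → Mixed (B (odd m)) (rowOf F i (odd m))
      go (inj₁ (e , _))               = clash e (odd-j i m)
      go (inj₂ (inj₁ (e , _)))        = clash e (odd-j i m)
      go (inj₂ (inj₂ (inj₁ (e , _)))) = clash e (odd-j i m)
      go (inj₂ (inj₂ (inj₂ (_ , p)))) = toMixed i (odd m) p

    const-row : ∀ l m → Const (rowOf F (odd l) (even m))
    const-row l m = go (allowed (i₀ + odd l) (j₀ + even m))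
      where
      go : Admissible (λ w → wire′ w (odd l) (even m)) → Const (rowOf F (odd l) (even m))
      go (inj₁ (_ , e , _))               = clash e (odd-i l (even m))
      go (inj₂ (inj₁ (_ , e , _)))        = clash e (odd-i l (even m))
      go (inj₂ (inj₂ (inj₁ (_ , _ , c)))) = toConst (odd l) (even m) c
      go (inj₂ (inj₂ (inj₂ (e , _))))     = clash e (even-j (odd l) m)

  nonperiodic : ∀ N → 0 ℕ.< N → ¬ (∀ i j → b (i + + N) j ≡ b i j)
  nonperiodic N 0<N per = aperiodic-Sudoku (<-wellFounded N) 0<N sudoku λ r τ n →
    trans (cong (λ x → wire (column r τ) x (j₀ + + 0)) (sym (+-assoc i₀ n (+ N))))
          (cong (_at-wire column r τ) (per (i₀ + n) (j₀ + + 0)))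

even? : ℤ → Bool
even? n with parity n
... | inj₁ _ = true
... | inj₂ _ = false

even?-even : ∀ m → even? (even m) ≡ true
even?-even m with parity (even m)
... | inj₁ _       = refl
... | inj₂ (n , e) = contradiction e (even≢odd m n)

even?-odd : ∀ m → even? (odd m) ≡ false
even?-odd m with parity (odd m)
... | inj₁ (n , e) = contradiction (sym e) (even≢odd n m)
... | inj₂ _       = refl

even?-step : ∀ n → even? (n + + 1) ≡ not (even? n)
even?-step n = go (parity n)
  where
  go : ∀ {n} → (Σ[ m ∈ ℤ ] n ≡ even m) ⊎ (Σ[ m ∈ ℤ ] n ≡ odd m) → even? (n + + 1) ≡ not (even? n)
  go (inj₁ (m , refl)) = trans (cong even? (+-comm (even m) (+ 1))) (trans (even?-odd m) (cong not (sym
      (even?-even m))))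
  go (inj₂ (m , refl)) = trans (cong even? (eq m)) (trans (even?-even (m + + 1)) (cong not (sym (even?-odd m))))
    where eq : ∀ m → + 1 + + 2 * m + + 1 ≡ + 2 * (m + + 1)
          eq = solve-∀

valuation-wire : ℤ → ℤ → Wire → Bool
valuation-wire i j (column r τ) = ν false (form r τ i j)
valuation-wire i j line         = ν false j
valuation-wire i j clock₁       = even? i
valuation-wire i j clock₂       = even? j

valuation-admissible : ∀ i j → Admissible (valuation-wire i j)
valuation-admissible i j = go (parity j) (parity i)
  where
  open Sudoku valuation-Sudoku
  go : ∀ {i j} → (Σ[ m ∈ ℤ ] j ≡ even m) ⊎ (Σ[ m ∈ ℤ ] j ≡ odd m) →
       (Σ[ l ∈ ℤ ] i ≡ even l) ⊎ (Σ[ l ∈ ℤ ] i ≡ odd l) → Admissible (valuation-wire i j)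
  go {i} (inj₂ (m , refl)) _ = inj₂ (inj₂ (inj₂ (even?-odd m , odd-row i m)))
  go (inj₁ (m , refl)) (inj₂ (l , refl)) = inj₂ (inj₂ (inj₁ (even?-even m , even?-odd l , const-row l m)))
  go (inj₁ (m , refl)) (inj₁ (l , refl)) =
    [ (λ c → inj₁ (even?-even m , even?-even l , c)) , (λ p → inj₂ (inj₁ (even?-even m , even?-even l , p))) ]′
      (ruled (even l) (even m))

valuation-along : ∀ w i j → valuation-wire (i + proj₁ (direction w)) (j + proj₂ (direction w)) w ≡ valuation-wire i j w
valuation-along (column r τ) i j = cong (ν false) (eq (coeff r τ) i j)
  where eq : ∀ c i j → i + - c + c * (j + + 1) ≡ i + c * j
        eq = solve-∀
valuation-along line   i j = cong (ν false) (+-identityʳ j)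
valuation-along clock₁ i j = cong even? (+-identityʳ i)
valuation-along clock₂ i j = cong even? (+-identityʳ j)

valuation-b : ℤ → ℤ → Vec Bool 13
valuation-b i j = assemble (valuation-wire i j)

valuation-wiring : Wiring valuation-b
valuation-wiring = record
  { allowed = λ i j → Admissible-cong (λ w → sym (assemble-at (valuation-wire i j) w)) (valuation-admissible i j)
  ; along   = λ ι i j → trans (lookup∘tabulate (λ κ → valuation-wire (i + proj₁ (direction (lookup wireList ι)))
        (j + proj₂ (direction (lookup wireList ι))) (lookup wireList κ)) ι)
      (trans (valuation-along (lookup wireList ι) i j) (sym (lookup∘tabulate (λ ι → valuation-wire i j
          (lookup wireList ι)) ι)))
  ; tick₁ = λ i j → even?-step i
  ; hold₁ = λ i j → cong even? (+-identityʳ i)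
  ; tick₂ = λ i j → even?-step j
  ; hold₂ = λ i j → cong even? (+-identityʳ j)
  }

theorem4p8 : Σ[ G₁ ∈ FinAbGroup ] Σ[ k ∈ ℕ ] Σ[ H ∈ (Fin k → FinAbGroup) ]
    Σ[ P ∈ Property (ℤ²× G₁) H ]
    (WeaklyExpressible (ℤ²× G₁) H P × Aperiodic (ℤ²× G₁) {H = H} P)
theorem4p8 = ⟦ G₁ ⟧ᴳ , 1 , P.Hᵥ , Solvable , solvable-weakly-expressible ,
  solvable-aperiodic valuation-wiring (λ W → FromWiring.nonperiodic W)
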